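{- Let $q$ be a prime power. Let $S \subseteq \mathbb{F}_{q^2}^*$ with $S=-S$ be such that $$\big|SSSS^{ -1}S^{ -1}S^{ -1}\big|\leq \frac{q^2-3}{2} \quad \text{or} \quad \big|SS^{ -1}S^{ -1}\mathbb{F}_q^*\big|\leq \frac{q^2-1}{2}.$$ If $A\subseteq \mathbb{F}_{q^2}$ satisfies $|A|=q$, $0,1\in A$, and $A-A \subseteq S \cup \{0\}$, then $A$ is the subfield $\mathbb{F}_q$ of $\mathbb{F}_{q^2}$. Equivalently, if $A\subseteq \mathbb{F}_{q^2}$ is a clique in the Cayley graph $\operatorname{Cay}(\mathbb{F}_{q^2}; S)$ with $|A|=q$ and $0,1\in A$, then $A$ is the subfield $\mathbb{F}_q$.
   Context: $\mathbb{F}_r$ is the finite field with $r$ elements, $\mathbb{F}_r^*=\mathbb{F}_r\setminus\{0\}$, and $\mathbb{F}_q$ is regarded as the unique subfield of order $q$ of $\mathbb{F}_{q^2}$. For subsets $A,B$ of a finite field, $A-B=\{a-b: a\in A, b\in B\}$, $-A=\{ -a: a\in A\}$, $AB=\{ab: a\in A, b\in B\}$ (iterated products, such as $SSSS^{ -1}S^{ -1}S^{ -1}$, are product sets of several factors), and, if $0\notin A$, $A^{ -1}=\{a^{ -1}: a\in A\}$. For an abelian group $G$ and $S\subseteq G\setminus\{0\}$ with $S=-S$, the Cayley graph $\operatorname{Cay}(G;S)$ has vertex set $G$, with two vertices adjacent if and only if their difference lies in $S$; here $G$ is the additive group of $\mathbb{F}_{q^2}$. A clique is a set of pairwise adjacent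 vertices, so $A$ is a clique if and only if $A-A\subseteq S\cup\{0\}$. -}

module Defs where

open import Algebra.Apartness.Bundles using (HeytingField)
open import Data.Fin.Base using (Fin)
open import Data.Fin.Properties using (any?; _≟_)
import Data.Fin.Subset as Sub
open import Data.Fin.Subset using (Subset; ⁅_⁆)
open import Data.Fin.Subset.Properties using (_∈?_)
open import Data.Nat.Base using (ℕ; suc; _^_)
open import Data.Nat.Primality using (Prime)
open import Data.Product.Base using (∃₂; _×_)
open import Data.Vec.Base using (tabulate)
open import Function.Bundles using (Inverse)
open import Level using (_⊔_; 0ℓ) renaming (suc to lsuc)
open import Relation.Binary.Core using (Rel)
open import Relation.Binary.PropositionalEquality as ≡ using (_≡_)
open import Relation.Nullary.Decidable using (_×-dec_; does)
open import Relation.Nullary.Negation using (¬_)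

IsPrimePower : ℕ → Set
IsPrimePower q = ∃₂ λ p k → Prime p × q ≡ p ^ suc k

-- For a finite setoid the apartness of a Heyting field is necessarily
-- x # y ⇔ ¬ x ≈ y, so these are exactly the fields with n elements.
record FiniteField c ℓ₁ ℓ₂ (n : ℕ) : Set (lsuc (c ⊔ ℓ₁ ⊔ ℓ₂)) where
  field
    heytingField : HeytingField c ℓ₁ ℓ₂

  open HeytingField heytingField public

  field
    enumeration : Inverse setoid (≡.setoid (Fin n))

  index : Carrier → Fin n
  index = Inverse.to enumeration

  element : Fin n → Carrier
  element = Inverse.from enumeration

-- Subsets of the field are subsets of Fin n, read through the enumeration;
-- their cardinality is then the one of Data.Fin.Subset.
module SubsetsOf {c ℓ₁ ℓ₂ n} (F : FiniteField c ℓ₁ ℓ₂ n) where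
  open FiniteField F hiding (0#; 1#)
  open FiniteField F public using (0#; 1#)

  infix  4 _∈_ _∉_
  infix  8 ⊝_
  infixl 7 _⊛_
  infixl 6 _⊖_
  infix  9 _⁻¹ _ˣ

  _∈_ : Carrier → Subset n → Set
  x ∈ A = index x Sub.∈ A

  _∉_ : Carrier → Subset n → Set
  x ∉ A = ¬ (x ∈ A)

  ｛0｝ : Subset n
  ｛0｝ = ⁅ index 0# ⁆

  image₂ : (Carrier → Carrier → Carrier) → Subset n → Subset n → Subset n
  image₂ _∙_ A B = tabulate λ i → does (any? λ j → any? λ k →
    (j ∈? A) ×-dec (k ∈? B) ×-dec (index (element j ∙ element k) ≟ i))

  _⊖_ : Subset n → Subset n → Subset n
  _⊖_ = image₂ _-_

  _⊛_ : Subset n → Subset n → Subset n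
  _⊛_ = image₂ _*_

  ⊝_ : Subset n → Subset n
  ⊝ A = tabulate λ i → does (any? λ j →
    (j ∈? A) ×-dec (index (- element j) ≟ i))

  -- HeytingField has no inverse operation: b is the inverse of a ∈ A when
  -- a * b ≈ 1#.  Only meant for A not containing 0.
  _⁻¹ : Subset n → Subset n
  A ⁻¹ = tabulate λ i → does (any? λ j →
    (j ∈? A) ×-dec (index (element j * element i) ≟ index 1#))

  _ˣ : Subset n → Subset n
  A ˣ = A Sub.─ ｛0｝

  record IsSubfield (K : Subset n) : Set (c ⊔ ℓ₁) where
    field
      0∈         : 0# ∈ K
      1∈         : 1# ∈ K
      +-closed   : ∀ x y → x ∈ K → y ∈ K → x + y ∈ K
      *-closed   : ∀ x y → x ∈ K → y ∈ K → x * y ∈ K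
      neg-closed : ∀ x → x ∈ K → - x ∈ K
      inv-closed : ∀ x y → x ∈ K → x * y ≈ 1# → y ∈ K

  -- Adjacency in Cay(F , +; S), a simple graph when 0# ∉ S and S ≡ ⊝ S.
  Cay : Subset n → Rel Carrier 0ℓ
  Cay S x y = x - y ∈ S

  IsClique : ∀ {ℓ} → Rel Carrier ℓ → Subset n → Set (c ⊔ ℓ₁ ⊔ ℓ)
  IsClique _~_ A = ∀ x y → x ∈ A → y ∈ A → ¬ (x ≈ y) → x ~ y

{-# OPTIONS --safe #-}

-- Write e j for elementary symmetric functions.  Suppose |C| = q and every z in a
-- set Z of nonzero elements lies outside (A − A)/(C − C).  For z in Z the sums
-- a + z c run exactly once through the field, so e j of them is e j of the field,
-- which is 0 for 0 < j < |Z|.  Being a polynomial of degree ≤ j in z, e j of the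
-- sums then vanishes identically, also at z = 0, where the sums are q copies of A;
-- by Frobenius, e i (A) = 0 whenever 0 < i and i q < |Z|.
--
-- The same applies to B = {0} ∪ {1/a : a ∈ A, a ≠ 0}, because
-- 1/a − 1/b = (b − a)/(a b) puts B − B inside S S⁻¹ S⁻¹ ∪ {0}.  Either hypothesis
-- gives a suitable C: B itself for the first, the subfield for the second, with
-- |Z| at least about q²/2.  Inversion reverses coefficients, so the two ranges of
-- vanishing cover everything, ∏ (X − a) = X^q − X, and A consists of the roots of
-- this polynomial, as does the subfield.
module Submission where

open import Algebra.Apartness.Bundles using (HeytingCommutativeRing)
open import Algebra.Bundles using (CommutativeRing)
open import Data.Fin.Base as Fin using (Fin)
import Data.Fin.Properties as Fin
import Data.Fin.Subset as Sub
open import Data.Fin.Subset using (Subset; ∣_∣; _⊆_; _∪_; inside; outside; ∁)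
import Data.Fin.Subset.Properties as Sub
open import Data.List.Base
  using (List; []; _∷_; _++_; length; map; replicate; concatMap; cartesianProduct; allFin)
open import Data.List.Properties using (length-++; length-map; length-tabulate; map-++; map-∘; ++-identityʳ)
import Data.List.Membership.Propositional as Prop
import Data.List.Membership.Propositional.Properties as Prop
import Data.List.Membership.Setoid as SetoidMembership
import Data.List.Membership.Setoid.Properties as Membership
import Data.List.Relation.Binary.Permutation.Setoid as SetoidPermutation
import Data.List.Relation.Binary.Permutation.Setoid.Properties as SetoidPermutationProperties
open import Data.List.Relation.Binary.Pointwise as Pointwise using (Pointwise; []; _∷_)
open import Data.List.Relation.Unary.All as All using (All; []; _∷_)
import Data.List.Relation.Unary.All.Properties as All
open import Data.List.Relation.Unary.AllPairs using ([]; _∷_)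
open import Data.List.Relation.Unary.Any using (here; there; any?)
import Data.List.Relation.Unary.Unique.Setoid as SetoidUnique
import Data.List.Relation.Unary.Unique.Setoid.Properties as Unique
open import Data.Nat.Base as ℕ using (ℕ; zero; suc)
open import Data.Nat.Combinatorics using (_C_; nCn≡1; nC1≡n; k>n⇒nCk≡0; nCk+nC[k+1]≡[n+1]C[k+1])
open import Data.Nat.Divisibility
  using (_∣_; divides; _∣?_; ∣⇒≤; 1∣_; *-monoʳ-∣; *-cancelˡ-∣; m∣m*n; ∣-trans)
open import Data.Nat.Primality using (Prime; euclidsLemma; prime⇒nonTrivial; prime⇒nonZero)
import Data.Nat.Properties as ℕ
open import Data.Nat.Solver using (module +-*-Solver)
open import Data.Product.Base using (∃; _×_; _,_; proj₁; proj₂)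
open import Data.Product.Relation.Binary.Pointwise.NonDependent using (_×ₛ_)
open import Data.Sum.Base using (_⊎_; inj₁; inj₂; [_,_]′)
open import Data.Vec.Base using ([]; _∷_; here; there; tabulate)
open import Data.Vec.Properties using (lookup⇒[]=; lookup∘tabulate)
open import Defs
open import Function.Base using (_∘_)
open import Function.Bundles using (Inverse)
open import Level using (_⊔_)
open import Relation.Binary.Bundles using (Setoid)
import Relation.Binary.Definitions as Binary
open import Relation.Binary.Definitions using (tri<; tri≈; tri>)
open import Relation.Binary.PropositionalEquality as ≡ using (_≡_)
open import Relation.Nullary.Decidable using (Dec; yes; no; does; dec-true; decidable-stable; map′; _×-dec_)
open import Relation.Nullary.Negation using (¬_; contradiction)
open import Relation.Unary using (Decidable)

-- Elementary symmetric functions of lists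

module ElementarySymmetric {c ℓ} (R : CommutativeRing c ℓ) where
  open CommutativeRing R hiding (zero)
  open import Algebra.Properties.Semiring.Exp semiring using (_^_; ^-congʳ)
  open import Algebra.Properties.Semiring.Mult semiring
    using (×-homo-+; ×-comm-*; ×-congˡ) renaming (_×_ to _·_)
  open import Algebra.Properties.CommutativeSemiring.Exp commutativeSemiring using (^-distrib-*)
  open import Algebra.Properties.CommutativeSemiring.Binomial commutativeSemiring using (theorem; binomialTerm)
  open import Algebra.Properties.Semiring.Sum semiring using (sum; sum-init-last; sum-cong-≋; sum-replicate-zero)
  open import Algebra.Properties.Ring ring using (-‿distribˡ-*; -‿involutive)
  open import Relation.Binary.Reasoning.Setoid setoid
  module ↭ = SetoidPermutation setoid
  open ↭ using (_↭_)
  open import Algebra.Solver.Ring.NaturalCoefficients.Default commutativeSemiring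
    using (solve; _:=_; _:+_; _:*_; con)

  1^n≈1 : ∀ n → 1# ^ n ≈ 1#
  1^n≈1 zero    = refl
  1^n≈1 (suc n) = trans (*-identityˡ _) (1^n≈1 n)

  0^n≈0 : ∀ {n} → 0 ℕ.< n → 0# ^ n ≈ 0#
  0^n≈0 (ℕ.s≤s _) = zeroˡ _

  e : List Carrier → ℕ → Carrier
  e xs       zero    = 1#
  e []       (suc j) = 0#
  e (x ∷ xs) (suc j) = e xs (suc j) + x * e xs j

  e-∷-cong : ∀ {x y xs ys} → x ≈ y → (∀ j → e xs j ≈ e ys j) →
             ∀ j → e (x ∷ xs) j ≈ e (y ∷ ys) j
  e-∷-cong x≈y xs≈ys zero    = refl
  e-∷-cong x≈y xs≈ys (suc j) = +-cong (xs≈ys (suc j)) (*-cong x≈y (xs≈ys j))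

  e-swap : ∀ x y xs j → e (x ∷ y ∷ xs) j ≈ e (y ∷ x ∷ xs) j
  e-swap x y xs zero          = refl
  e-swap x y xs (suc zero)    = identity _ x y
    where
    identity : ∀ a x y → a + y * 1# + x * 1# ≈ a + x * 1# + y * 1#
    identity = solve 3 (λ a x y → a :+ y :* con 1 :+ x :* con 1 := a :+ x :* con 1 :+ y :* con 1) refl
  e-swap x y xs (suc (suc j)) = identity _ _ _ x y
    where
    identity : ∀ a b c x y → a + y * b + x * (b + y * c) ≈ a + x * b + y * (b + x * c)
    identity = solve 5 (λ a b c x y → a :+ y :* b :+ x :* (b :+ y :* c) := a :+ x :* b :+ y :* (b :+ x :* c)) refl

  e-pointwise : ∀ {xs ys} → Pointwise _≈_ xs ys → ∀ j → e xs j ≈ e ys j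
  e-pointwise []        j = refl
  e-pointwise (eq ∷ pw) j = e-∷-cong eq (e-pointwise pw) j

  e-↭ : ∀ {xs ys} → xs ↭ ys → ∀ j → e xs j ≈ e ys j
  e-↭ (↭.refl pw)      j = e-pointwise pw j
  e-↭ (↭.prep eq p)    j = e-∷-cong eq (e-↭ p) j
  e-↭ (↭.swap eq eq′ p) j = trans (e-∷-cong eq (e-∷-cong eq′ (e-↭ p)) j) (e-swap _ _ _ j)
  e-↭ (↭.trans p p′)   j = trans (e-↭ p j) (e-↭ p′ j)

  e-beyond : ∀ xs {j} → length xs ℕ.< j → e xs j ≈ 0#
  e-beyond []       {suc j} _           = refl
  e-beyond (x ∷ xs) {suc j} (ℕ.s≤s l<j) = begin
    e xs (suc j) + x * e xs j  ≈⟨ +-cong (e-beyond xs (ℕ.m≤n⇒m≤1+n l<j)) (*-congˡ (e-beyond xs l<j)) ⟩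
    0# + x * 0#                ≈⟨ trans (+-identityˡ _) (zeroʳ x) ⟩
    0#                         ∎

  e-0∷ : ∀ xs j → e (0# ∷ xs) j ≈ e xs j
  e-0∷ xs zero    = refl
  e-0∷ xs (suc j) = trans (+-congˡ (zeroˡ _)) (+-identityʳ _)

  e-zeros : ∀ xs → All (_≈ 0#) xs → ∀ j → e xs (suc j) ≈ 0#
  e-zeros []       []         j = refl
  e-zeros (x ∷ xs) (x≈0 ∷ xs≈0) j = begin
    e xs (suc j) + x * e xs j  ≈⟨ +-cong (e-zeros xs xs≈0 j) (trans (*-congʳ x≈0) (zeroˡ _)) ⟩
    0# + 0#                    ≈⟨ +-identityˡ 0# ⟩
    0#                         ∎

  e-scale : ∀ t xs j → e (map (t *_) xs) j ≈ t ^ j * e xs j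
  e-scale t xs       zero    = sym (*-identityˡ 1#)
  e-scale t []       (suc j) = sym (zeroʳ _)
  e-scale t (x ∷ xs) (suc j) = begin
    e (map (t *_) xs) (suc j) + t * x * e (map (t *_) xs) j
      ≈⟨ +-cong (e-scale t xs (suc j)) (*-congˡ (e-scale t xs j)) ⟩
    t * t ^ j * e xs (suc j) + t * x * (t ^ j * e xs j)
      ≈⟨ identity t x (t ^ j) (e xs (suc j)) (e xs j) ⟩
    t * t ^ j * (e xs (suc j) + x * e xs j) ∎
    where
    identity : ∀ t x s a b → t * s * a + t * x * (s * b) ≈ t * s * (a + x * b)
    identity = solve 5 (λ t x s a b → t :* s :* a :+ t :* x :* (s :* b) := t :* s :* (a :+ x :* b)) refl

  e₁-translate : ∀ t xs → e (map (t +_) xs) 1 ≈ e xs 1 + length xs · t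
  e₁-translate t []       = sym (+-identityʳ 0#)
  e₁-translate t (x ∷ xs) = begin
    e (map (t +_) xs) 1 + (t + x) * 1#      ≈⟨ +-congʳ (e₁-translate t xs) ⟩
    e xs 1 + length xs · t + (t + x) * 1#   ≈⟨ identity (e xs 1) (length xs · t) t x ⟩
    e xs 1 + x * 1# + (t + length xs · t)   ∎
    where
    identity : ∀ a b t x → a + b + (t + x) * 1# ≈ a + x * 1# + (t + b)
    identity = solve 4 (λ a b t x → a :+ b :+ (t :+ x) :* con 1 := a :+ x :* con 1 :+ (t :+ b)) refl

  -- Deleting x leaves the geometric progression e xs j = (- x) ^ j.
  e-delete : ∀ x xs → (∀ j → 0 ℕ.< j → j ℕ.< suc (length xs) → e (x ∷ xs) j ≈ 0#) →
             e (x ∷ xs) (suc (length xs)) ≈ - ((- x) ^ suc (length xs))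
  e-delete x xs vanish = begin
    e xs (suc m) + x * e xs m  ≈⟨ +-cong (e-beyond xs (ℕ.n<1+n m)) (*-congˡ (geometric m ℕ.≤-refl)) ⟩
    0# + x * (- x) ^ m         ≈⟨ identity x ((- x) ^ m) ⟩
    - (- x * (- x) ^ m)        ∎
    where
    m = length xs
    identity : ∀ x s → 0# + x * s ≈ - (- x * s)
    identity x s = trans (+-identityˡ _) (sym (trans (-‿cong (sym (-‿distribˡ-* x s))) (-‿involutive _)))
    rearrange : ∀ a x b → a ≈ (a + x * b) + (- x) * b
    rearrange a x b = sym (begin
      (a + x * b) + - x * b   ≈⟨ solve 4 (λ a x y b → (a :+ x :* b) :+ y :* b := a :+ (x :+ y) :* b) refl a x (- x) b ⟩
      a + (x + - x) * b       ≈⟨ +-congˡ (trans (*-congʳ (-‿inverseʳ x)) (zeroˡ b)) ⟩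
      a + 0#                  ≈⟨ +-identityʳ a ⟩
      a                       ∎)
    geometric : ∀ j → j ℕ.≤ m → e xs j ≈ (- x) ^ j
    geometric zero    _   = refl
    geometric (suc j) j<m = begin
      e xs (suc j)                              ≈⟨ rearrange _ x (e xs j) ⟩
      (e xs (suc j) + x * e xs j) + - x * e xs j
        ≈⟨ +-cong (vanish (suc j) (ℕ.s≤s ℕ.z≤n) (ℕ.s≤s j<m)) (*-congˡ (geometric j (ℕ.<⇒≤ j<m))) ⟩
      0# + - x * (- x) ^ j                      ≈⟨ +-identityˡ _ ⟩
      - x * (- x) ^ j                           ∎

  -- Since 1 + x T = x T (1 + x⁻¹ T⁻¹), passing to inverses reverses the coefficients of ∏ (1 + x T)
  -- up to the factor ∏ x. Tying the indices by a sum rather than a subtraction lets the induction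
  -- lower either one.
  e-inverses : ∀ (inv : Carrier → Carrier) xs → All (λ x → x * inv x ≈ 1#) xs →
               ∀ i k → i ℕ.+ k ≡ length xs →
               e xs i ≈ e xs (length xs) * e (map inv xs) k
  e-inverses inv [] [] zero zero _ = sym (*-identityˡ 1#)
  e-inverses inv (x ∷ xs) (x∙x⁻¹≈1 ∷ hs) i k i+k≡ = begin
    e (x ∷ xs) i                   ≈⟨ go i k i+k≡ ⟩
    x * p * e (inv x ∷ map inv xs) k
      -- The summand `e xs (suc (length xs))` lies beyond the degree, so the top coefficient of
      -- `x ∷ xs` is `x * p`.
      ≈⟨ *-congʳ (sym (trans (+-congʳ (e-beyond xs ℕ.≤-refl)) (+-identityˡ _))) ⟩
    (e xs (suc (length xs)) + x * p) * e (inv x ∷ map inv xs) k ∎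
    where
    p = e xs (length xs)
    y = inv x
    ys = map inv xs
    expand : ∀ x y p a b → x * y ≈ 1# → x * p * (a + y * b) ≈ x * (p * a) + p * b
    expand x y p a b xy≈1 = begin
      x * p * (a + y * b)               ≈⟨ id₁ x y p a b ⟩
      x * (p * a) + x * y * (p * b)     ≈⟨ +-congˡ (trans (*-congʳ xy≈1) (*-identityˡ _)) ⟩
      x * (p * a) + p * b               ∎
      where
      id₁ : ∀ x y p a b → x * p * (a + y * b) ≈ x * (p * a) + x * y * (p * b)
      id₁ = solve 5 (λ x y p a b → x :* p :* (a :+ y :* b) := x :* (p :* a) :+ x :* y :* (p :* b)) refl
    go : ∀ i k → i ℕ.+ k ≡ suc (length xs) → e (x ∷ xs) i ≈ x * p * e (y ∷ ys) k
    -- The coefficient of `ys` just beyond its degree is 0; it is inserted so that `expand` applies.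
    go zero (suc k) eq with ≡.refl ← ℕ.suc-injective eq = begin
      1#                       ≈⟨ e-inverses inv xs hs 0 (length xs) ≡.refl ⟩
      p * e ys (length xs)     ≈⟨ +-identityˡ _ ⟨
      0# + p * e ys (length xs)
        ≈⟨ +-congʳ (trans (*-congˡ (*-congˡ beyond)) (trans (*-congˡ (zeroʳ p)) (zeroʳ x))) ⟨
      x * (p * e ys (suc (length xs))) + p * e ys (length xs)  ≈⟨ expand x y p _ _ x∙x⁻¹≈1 ⟨
      x * p * e (y ∷ ys) (suc (length xs)) ∎
      where
      beyond : e ys (suc (length xs)) ≈ 0#
      beyond = e-beyond ys (ℕ.≤-reflexive (≡.cong suc (length-map inv xs)))
    go (suc i) zero eq with ≡.refl ← ≡.trans (≡.sym (ℕ.+-identityʳ i)) (ℕ.suc-injective eq) = begin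
      e xs (suc (length xs)) + x * p  ≈⟨ +-congʳ (e-beyond xs ℕ.≤-refl) ⟩
      0# + x * p                      ≈⟨ identity (x * p) ⟩
      x * p * 1#                      ∎
      where
      identity : ∀ a → 0# + a ≈ a * 1#
      identity = solve 1 (λ a → con 0 :+ a := a :* con 1) refl
    go (suc i) (suc k) eq = begin
      e xs (suc i) + x * e xs i
        ≈⟨ +-cong (e-inverses inv xs hs (suc i) k (≡.trans (≡.sym (ℕ.+-suc i k)) eq′))
                  (*-congˡ (e-inverses inv xs hs i (suc k) eq′)) ⟩
      p * e ys k + x * (p * e ys (suc k))  ≈⟨ +-comm _ _ ⟩
      x * (p * e ys (suc k)) + p * e ys k  ≈⟨ expand x y p _ _ x∙x⁻¹≈1 ⟨
      x * p * e (y ∷ ys) (suc k) ∎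
      where eq′ = ℕ.suc-injective eq

  -- Generating polynomials and the Frobenius map

  convolution : (ℕ → Carrier) → (ℕ → Carrier) → ℕ → Carrier
  convolution f g zero    = f 0 * g 0
  convolution f g (suc j) = f 0 * g (suc j) + convolution (f ∘ suc) g j

  convolution-cong : ∀ {f f′} g → (∀ i → f i ≈ f′ i) → ∀ j → convolution f g j ≈ convolution f′ g j
  convolution-cong g f≈ zero    = *-congʳ (f≈ 0)
  convolution-cong g f≈ (suc j) = +-cong (*-congʳ (f≈ 0)) (convolution-cong g (f≈ ∘ suc) j)

  convolution-zeroˡ : ∀ g j → convolution (λ _ → 0#) g j ≈ 0#
  convolution-zeroˡ g zero    = zeroˡ _
  convolution-zeroˡ g (suc j) = trans (+-cong (zeroˡ _) (convolution-zeroˡ g j)) (+-identityˡ 0#)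

  convolution-linear : ∀ x f h g j →
    convolution (λ i → f i + x * h i) g j ≈ convolution f g j + x * convolution h g j
  convolution-linear x f h g zero    = identity (f 0) x (h 0) (g 0)
    where
    identity : ∀ a x b c → (a + x * b) * c ≈ a * c + x * (b * c)
    identity = solve 4 (λ a x b c → (a :+ x :* b) :* c := a :* c :+ x :* (b :* c)) refl
  convolution-linear x f h g (suc j) =
    trans (+-congˡ (convolution-linear x (f ∘ suc) (h ∘ suc) g j))
          (identity (f 0) x (h 0) (g (suc j)) _ _)
    where
    identity : ∀ a x b c u v → (a + x * b) * c + (u + x * v) ≈ a * c + u + x * (b * c + v)
    identity = solve 6 (λ a x b c u v → (a :+ x :* b) :* c :+ (u :+ x :* v) := a :* c :+ u :+ x :* (b :* c :+ v)) refl

  -- Concatenating lists multiplies their polynomials ∏ (1 + x T), so the coefficients convolve;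
  -- `convolution-linear` peels off one factor at a time.
  e-++ : ∀ xs ys j → e (xs ++ ys) j ≈ convolution (e xs) (e ys) j
  e-++ []       ys zero    = sym (*-identityˡ 1#)
  e-++ []       ys (suc j) = sym (trans (+-cong (*-identityˡ _) (convolution-zeroˡ (e ys) j)) (+-identityʳ _))
  e-++ (x ∷ xs) ys zero    = sym (*-identityˡ 1#)
  e-++ (x ∷ xs) ys (suc j) = begin
    e (xs ++ ys) (suc j) + x * e (xs ++ ys) j
      ≈⟨ +-cong (e-++ xs ys (suc j)) (*-congˡ (e-++ xs ys j)) ⟩
    1# * e ys (suc j) + convolution (e xs ∘ suc) (e ys) j + x * convolution (e xs) (e ys) j
      ≈⟨ +-assoc _ _ _ ⟩
    1# * e ys (suc j) + (convolution (e xs ∘ suc) (e ys) j + x * convolution (e xs) (e ys) j)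
      ≈⟨ +-congˡ (convolution-linear x (e xs ∘ suc) (e xs) (e ys) j) ⟨
    convolution (e (x ∷ xs)) (e ys) (suc j) ∎

  -- The coefficients of T ^ m, from which the sequence of 1 + x ^ q T ^ q is assembled below.
  monomial : ℕ → ℕ → Carrier
  monomial zero    zero    = 1#
  monomial zero    (suc i) = 0#
  monomial (suc m) zero    = 0#
  monomial (suc m) (suc i) = monomial m i

  monomial-≢ : ∀ m i → ¬ m ≡ i → monomial m i ≈ 0#
  monomial-≢ zero    zero    m≢i = contradiction ≡.refl m≢i
  monomial-≢ zero    (suc i) m≢i = refl
  monomial-≢ (suc m) zero    m≢i = refl
  monomial-≢ (suc m) (suc i) m≢i = monomial-≢ m i (m≢i ∘ ≡.cong suc)

  monomial-≡ : ∀ m → monomial m m ≈ 1#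
  monomial-≡ zero    = refl
  monomial-≡ (suc m) = monomial-≡ m

  convolution-monomial : ∀ m g j → convolution (monomial m) g (m ℕ.+ j) ≈ g j
  convolution-monomial zero    g zero    = *-identityˡ _
  convolution-monomial zero    g (suc j) =
    trans (+-cong (*-identityˡ _) (convolution-zeroˡ g j)) (+-identityʳ _)
  convolution-monomial (suc m) g j       =
    trans (+-congʳ (zeroˡ _)) (trans (+-identityˡ _) (convolution-monomial m g j))

  -- These are the coefficients of (1 + x T) ^ m, and Pascal's rule drives the induction.
  e-replicate : ∀ m x j → e (replicate m x) j ≈ (m C j) · x ^ j
  e-replicate zero    x zero    = sym (+-identityʳ 1#)
  e-replicate zero    x (suc j) = refl
  e-replicate (suc m) x zero    = sym (+-identityʳ 1#)
  e-replicate (suc m) x (suc j) = begin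
    e (replicate m x) (suc j) + x * e (replicate m x) j
      ≈⟨ +-cong (e-replicate m x (suc j)) (*-congˡ (e-replicate m x j)) ⟩
    (m C suc j) · x ^ suc j + x * ((m C j) · x ^ j)
      ≈⟨ +-congˡ (×-comm-* (m C j) x (x ^ j)) ⟩
    (m C suc j) · x ^ suc j + (m C j) · x ^ suc j
      ≈⟨ trans (+-comm _ _) (sym (×-homo-+ (x ^ suc j) (m C j) (m C suc j))) ⟩
    (m C j ℕ.+ m C suc j) · x ^ suc j
      ≈⟨ ×-congˡ (nCk+nC[k+1]≡[n+1]C[k+1] m j) ⟩
    (suc m C suc j) · x ^ suc j ∎

  -- The vanishing of the interior binomial coefficients is a hypothesis here; for powers of the
  -- characteristic p it will follow from divisibility by p.
  module FrobeniusExponent (q : ℕ) (0<q : 0 ℕ.< q)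
    (binomial-vanishes : ∀ {j} → 0 ℕ.< j → j ℕ.< q → ∀ x → (q C j) · x ≈ 0#) where

    -- The interior coefficients of (1 + x T) ^ q vanish, leaving 1 + x ^ q T ^ q.
    e-replicate-q : ∀ x j → e (replicate q x) j ≈ monomial 0 j + x ^ q * monomial q j
    e-replicate-q x zero = sym (begin
      1# + x ^ q * monomial q 0  ≈⟨ +-congˡ (*-congˡ (monomial-≢ q 0 (ℕ.<⇒≢ 0<q ∘ ≡.sym))) ⟩
      1# + x ^ q * 0#            ≈⟨ trans (+-congˡ (zeroʳ _)) (+-identityʳ 1#) ⟩
      1#                         ∎)
    e-replicate-q x j@(suc _) = trans (e-replicate q x j) (trans coefficient (sym (+-identityˡ _)))
      where
      coefficient : (q C j) · x ^ j ≈ x ^ q * monomial q j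
      coefficient with ℕ.<-cmp j q
      ... | tri< j<q j≢q _ = trans (binomial-vanishes (ℕ.s≤s ℕ.z≤n) j<q (x ^ j))
                                   (sym (trans (*-congˡ (monomial-≢ q j (j≢q ∘ ≡.sym))) (zeroʳ _)))
      ... | tri≈ _ ≡.refl _ = trans (×-congˡ (nCn≡1 j))
                                   (trans (+-identityʳ _) (sym (trans (*-congˡ (monomial-≡ j)) (*-identityʳ _))))
      ... | tri> _ j≢q j>q = trans (×-congˡ (k>n⇒nCk≡0 j>q))
                                   (sym (trans (*-congˡ (monomial-≢ q j (j≢q ∘ ≡.sym))) (zeroʳ _)))

    -- Repeating every entry q times turns ∏ (1 + x T) into ∏ (1 + x ^ q T ^ q), whose coefficients
    -- are read off with T ^ q as the variable.
    e-concatMap-replicate : ∀ xs i → e (concatMap (replicate q) xs) (i ℕ.* q) ≈ e (map (_^ q) xs) i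
    e-concatMap-replicate xs       zero    = refl
    e-concatMap-replicate []       (suc i) = e-beyond [] (ℕ.≤-trans 0<q (ℕ.m≤m+n q (i ℕ.* q)))
    e-concatMap-replicate (x ∷ xs) (suc i) = begin
      e (replicate q x ++ ys) (q ℕ.+ i ℕ.* q)
        ≈⟨ e-++ (replicate q x) ys (q ℕ.+ i ℕ.* q) ⟩
      convolution (e (replicate q x)) (e ys) (q ℕ.+ i ℕ.* q)
        ≈⟨ convolution-cong (e ys) (e-replicate-q x) (q ℕ.+ i ℕ.* q) ⟩
      convolution (λ j → monomial 0 j + x ^ q * monomial q j) (e ys) (q ℕ.+ i ℕ.* q)
        ≈⟨ convolution-linear (x ^ q) (monomial 0) (monomial q) (e ys) (q ℕ.+ i ℕ.* q) ⟩
      convolution (monomial 0) (e ys) (q ℕ.+ i ℕ.* q) + x ^ q * convolution (monomial q) (e ys) (q ℕ.+ i ℕ.* q)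
        ≈⟨ +-cong (convolution-monomial 0 (e ys) (q ℕ.+ i ℕ.* q)) (*-congˡ (convolution-monomial q (e ys) (i ℕ.* q))) ⟩
      e ys (suc i ℕ.* q) + x ^ q * e ys (i ℕ.* q)
        ≈⟨ +-cong (e-concatMap-replicate xs (suc i)) (*-congˡ (e-concatMap-replicate xs i)) ⟩
      e (map (_^ q) xs) (suc i) + x ^ q * e (map (_^ q) xs) i ∎
      where ys = concatMap (replicate q) xs

    frobenius-+ : ∀ x y → (x + y) ^ q ≈ x ^ q + y ^ q
    frobenius-+ x y = go q 0<q binomial-vanishes
      where
      -- The module parameter q is generalised so that it can be matched as `suc r`.
      go : ∀ q → 0 ℕ.< q → (∀ {j} → 0 ℕ.< j → j ℕ.< q → ∀ x → (q C j) · x ≈ 0#) →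
           (x + y) ^ q ≈ x ^ q + y ^ q
      go (suc r) _ vanish = begin
        (x + y) ^ suc r                                   ≈⟨ theorem (suc r) x y ⟩
        t Fin.zero + sum (t ∘ Fin.suc)                    ≈⟨ +-congˡ (sum-init-last (t ∘ Fin.suc)) ⟩
        t Fin.zero + (sum (λ i → t (Fin.suc (Fin.inject₁ i))) + t (Fin.suc (Fin.fromℕ r)))
          ≈⟨ +-cong first (+-cong (trans (sum-cong-≋ middle) (sum-replicate-zero r)) last) ⟩
        y ^ suc r + (0# + x ^ suc r)                      ≈⟨ +-congˡ (+-identityˡ _) ⟩
        y ^ suc r + x ^ suc r                             ≈⟨ +-comm _ _ ⟩
        x ^ suc r + y ^ suc r                             ∎
        where
        t = binomialTerm x y (suc r)
        first : t Fin.zero ≈ y ^ suc r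
        first = trans (+-identityʳ _) (*-identityˡ _)
        middle : ∀ i → t (Fin.suc (Fin.inject₁ i)) ≈ 0#
        middle i = vanish (ℕ.s≤s ℕ.z≤n) (ℕ.s≤s (≡.subst (ℕ._< r) (≡.sym (Fin.toℕ-inject₁ i)) (Fin.toℕ<n i))) _
        last : t (Fin.suc (Fin.fromℕ r)) ≈ x ^ suc r
        last = last-at (Fin.toℕ (Fin.fromℕ r)) (Fin.toℕ-fromℕ r)
          where
          last-at : ∀ k → k ≡ r → (suc r C suc k) · (x ^ suc k * y ^ (r ℕ.∸ k)) ≈ x ^ suc r
          last-at k ≡.refl = begin
            (suc r C suc r) · (x ^ suc r * y ^ (r ℕ.∸ r))  ≈⟨ ×-congˡ (nCn≡1 (suc r)) ⟩
            1 · (x ^ suc r * y ^ (r ℕ.∸ r))                ≈⟨ +-identityʳ _ ⟩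
            x ^ suc r * y ^ (r ℕ.∸ r)                      ≈⟨ *-congˡ (^-congʳ y (ℕ.n∸n≡0 r)) ⟩
            x ^ suc r * 1#                                 ≈⟨ *-identityʳ _ ⟩
            x ^ suc r                                      ∎

    -- The functions `e` are built from sums and products, and the q-th power map respects both.
    e-map-^q : ∀ xs i → e (map (_^ q) xs) i ≈ e xs i ^ q
    e-map-^q xs       zero    = sym (1^n≈1 q)
    e-map-^q []       (suc i) = sym (0^n≈0 0<q)
    e-map-^q (x ∷ xs) (suc i) = begin
      e (map (_^ q) xs) (suc i) + x ^ q * e (map (_^ q) xs) i
        ≈⟨ +-cong (e-map-^q xs (suc i)) (*-congˡ (e-map-^q xs i)) ⟩
      e xs (suc i) ^ q + x ^ q * e xs i ^ q     ≈⟨ +-congˡ (^-distrib-* x (e xs i) q) ⟨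
      e xs (suc i) ^ q + (x * e xs i) ^ q       ≈⟨ frobenius-+ _ _ ⟨
      e (x ∷ xs) (suc i) ^ q                    ∎

-- Binomial coefficients of prime powers

[1+k]*[1+n]C[1+k]≡[1+n]*nCk : ∀ n k → suc k ℕ.* (suc n C suc k) ≡ suc n ℕ.* (n C k)
[1+k]*[1+n]C[1+k]≡[1+n]*nCk n zero = begin
  1 ℕ.* (suc n C 1)  ≡⟨ ≡.trans (ℕ.*-identityˡ _) (nC1≡n (suc n)) ⟩
  suc n              ≡⟨ ℕ.*-identityʳ (suc n) ⟨
  suc n ℕ.* 1        ∎
  where open ≡.≡-Reasoning
[1+k]*[1+n]C[1+k]≡[1+n]*nCk zero (suc k) = begin
  suc (suc k) ℕ.* (1 C suc (suc k))
    ≡⟨ ≡.cong (suc (suc k) ℕ.*_) (k>n⇒nCk≡0 {1} {suc (suc k)} (ℕ.s≤s (ℕ.s≤s ℕ.z≤n))) ⟩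
  suc (suc k) ℕ.* 0                  ≡⟨ ℕ.*-zeroʳ (suc (suc k)) ⟩
  0                                  ≡⟨ ≡.cong (1 ℕ.*_) (k>n⇒nCk≡0 {0} {suc k} (ℕ.s≤s ℕ.z≤n)) ⟨
  1 ℕ.* (0 C suc k)                  ∎
  where open ≡.≡-Reasoning
-- Pascal's rule splits the left side, each summand has its own induction hypothesis, and Pascal's
-- rule for n reassembles them.
[1+k]*[1+n]C[1+k]≡[1+n]*nCk (suc n) (suc k) = begin
  (2 ℕ.+ k) ℕ.* (suc (suc n) C suc (suc k))
    ≡⟨ ≡.cong ((2 ℕ.+ k) ℕ.*_) (nCk+nC[k+1]≡[n+1]C[k+1] (suc n) (suc k)) ⟨
  (2 ℕ.+ k) ℕ.* (x ℕ.+ (suc n C suc (suc k)))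
    ≡⟨ solve 3 (λ k x y → (con 2 :+ k) :* (x :+ y) := x :+ (con 1 :+ k) :* x :+ (con 2 :+ k) :* y) ≡.refl k x _ ⟩
  x ℕ.+ suc k ℕ.* x ℕ.+ (2 ℕ.+ k) ℕ.* (suc n C suc (suc k))
    ≡⟨ ≡.cong₂ (λ u v → x ℕ.+ u ℕ.+ v) ([1+k]*[1+n]C[1+k]≡[1+n]*nCk n k) ([1+k]*[1+n]C[1+k]≡[1+n]*nCk n (suc k)) ⟩
  x ℕ.+ suc n ℕ.* (n C k) ℕ.+ suc n ℕ.* (n C suc k)
    ≡⟨ solve 4 (λ x n u v → x :+ (con 1 :+ n) :* u :+ (con 1 :+ n) :* v := x :+ (con 1 :+ n) :* (u :+ v)) ≡.refl x n _ _ ⟩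
  x ℕ.+ suc n ℕ.* ((n C k) ℕ.+ (n C suc k))
    ≡⟨ ≡.cong (λ u → x ℕ.+ suc n ℕ.* u) (nCk+nC[k+1]≡[n+1]C[k+1] n k) ⟩
  suc (suc n) ℕ.* x ∎
  where
  open ≡.≡-Reasoning
  open +-*-Solver
  x = suc n C suc k

module _ {p} (p-prime : Prime p) where
  private instance
    p-nonZero : ℕ.NonZero p
    p-nonZero = prime⇒nonZero p-prime

  -- By Euclid's lemma a factor p of m n must come from m; it is cancelled and the argument repeats.
  p^k∣m*n∧p∤n⇒p^k∣m : ∀ k m n → p ℕ.^ k ∣ m ℕ.* n → ¬ (p ∣ n) → p ℕ.^ k ∣ m
  p^k∣m*n∧p∤n⇒p^k∣m zero    m n _         _   = 1∣ m
  p^k∣m*n∧p∤n⇒p^k∣m (suc k) m n p^1+k∣m*n p∤n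
    with euclidsLemma m n p-prime (∣-trans (m∣m*n (p ℕ.^ k)) p^1+k∣m*n)
  ... | inj₂ p∣n = contradiction p∣n p∤n
  ... | inj₁ (divides r ≡.refl) = ≡.subst (p ℕ.* p ℕ.^ k ∣_) (ℕ.*-comm p r)
    (*-monoʳ-∣ p (p^k∣m*n∧p∤n⇒p^k∣m k r n
      (*-cancelˡ-∣ p (≡.subst (p ℕ.* p ℕ.^ k ∣_)
        (≡.trans (≡.cong (ℕ._* n) (ℕ.*-comm r p)) (ℕ.*-assoc p r n)) p^1+k∣m*n)) p∤n))

  -- The absorption identity makes p ^ k a divisor of j times the binomial coefficient. If p did not
  -- divide the latter, p ^ k would divide j, which is too small.
  p∣p^kCj : ∀ k {j} → 0 ℕ.< j → j ℕ.< p ℕ.^ k → p ∣ (p ℕ.^ k) C j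
  p∣p^kCj k {j} 0<j j<q with p ∣? ((p ℕ.^ k) C j)
  ... | yes p∣C = p∣C
  ... | no  p∤C = contradiction (∣⇒≤ {{ℕ.>-nonZero 0<j}} q∣j) (ℕ.<⇒≱ j<q)
    where
    q∣j*C : ∀ q j → 0 ℕ.< j → 0 ℕ.< q → q ∣ j ℕ.* (q C j)
    q∣j*C (suc m) (suc i) _ _ = ≡.subst (suc m ∣_) (≡.sym ([1+k]*[1+n]C[1+k]≡[1+n]*nCk m i)) (m∣m*n (m C i))
    q∣j : p ℕ.^ k ∣ j
    q∣j = p^k∣m*n∧p∤n⇒p^k∣m k j _ (q∣j*C (p ℕ.^ k) j 0<j (ℕ.<-trans 0<j j<q)) p∤C

-- Permutations of lists without repetitions

module UniqueLists {a ℓ} (S : Setoid a ℓ) where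
  open Setoid S
  open SetoidMembership S using (_∈_)
  open SetoidUnique S using (Unique)
  module ↭ = SetoidPermutation S
  open ↭ using (_↭_)
  open SetoidPermutationProperties S using (shift; ∈-resp-↭; xs↭ys⇒|xs|≡|ys|)

  ∈⇒∃↭ : ∀ {x ys} → x ∈ ys → ∃ λ zs → x ∷ zs ↭ ys
  ∈⇒∃↭ x∈ys with as , bs , w , x≈w , ys≋ ← Membership.∈-∃++ S x∈ys =
    as ++ bs , ↭.↭-sym (↭.trans (↭.refl ys≋) (shift (sym x≈w) as bs))

  ∈-tail : ∀ {x y ys} → ¬ x ≈ y → y ∈ x ∷ ys → y ∈ ys
  ∈-tail x≉y (here y≈x)   = contradiction (sym y≈x) x≉y
  ∈-tail x≉y (there y∈ys) = y∈ys

  complement-↭ : ∀ {xs ys} → Unique xs → All (_∈ ys) xs → ∃ λ zs → xs ++ zs ↭ ys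
  complement-↭ {[]}     {ys} _ _ = ys , ↭.↭-refl
  complement-↭ {x ∷ xs} {ys} (x≉xs ∷ xs!) (x∈ys ∷ xs⊆ys)
    with vs , x∷vs↭ys ← ∈⇒∃↭ x∈ys
    with zs , xs++zs↭vs ← complement-↭ xs!
           (All.zipWith (λ (x≉y , y∈ys) → ∈-tail x≉y (∈-resp-↭ (↭.↭-sym x∷vs↭ys) y∈ys)) (x≉xs , xs⊆ys))
    = zs , ↭.trans (↭.↭-prep x xs++zs↭vs) x∷vs↭ys

  -- Pigeonhole: completing `xs` to a permutation of `ys` leaves no room for a further entry.
  unique⇒↭ : ∀ {xs ys} → Unique xs → All (_∈ ys) xs → length ys ℕ.≤ length xs → xs ↭ ys
  unique⇒↭ {xs} {ys} xs! xs⊆ys |ys|≤|xs| with complement-↭ xs! xs⊆ys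
  ... | []     , p = ≡.subst (_↭ ys) (++-identityʳ xs) p
  ... | z ∷ zs , p = contradiction |ys|≤|xs| (ℕ.<⇒≱ (begin-strict
    length xs                       <⟨ ℕ.m<m+n (length xs) (ℕ.s≤s ℕ.z≤n) ⟩
    length xs ℕ.+ length (z ∷ zs)   ≡⟨ length-++ xs ⟨
    length (xs ++ z ∷ zs)           ≡⟨ xs↭ys⇒|xs|≡|ys| p ⟩
    length ys                       ∎))
    where open ℕ.≤-Reasoning

module _ {a b ℓ₁ ℓ₂} (S : Setoid a ℓ₁) (T : Setoid b ℓ₂) where
  private
    module S = Setoid S
    module T = Setoid T

  -- Injectivity is asked for only where P holds: inversion is controlled away from 0, and (a, c) ↦
  -- a + z c only on a product of two lists.
  unique-map-on : ∀ {p} {f : S.Carrier → T.Carrier} {P : S.Carrier → Set p} →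
                  (∀ {x y} → P x → P y → f x T.≈ f y → x S.≈ y) →
                  ∀ {xs} → All P xs → SetoidUnique.Unique S xs → SetoidUnique.Unique T (map f xs)
  unique-map-on inj []         []           = []
  unique-map-on inj (px ∷ pxs) (x≉xs ∷ xs!) =
    All.map⁺ (All.zipWith (λ (py , x≉y) fx≈fy → x≉y (inj px py fx≈fy)) (pxs , x≉xs)) ∷ unique-map-on inj pxs xs!

-- Polynomial functions of bounded degree and their roots

module PolynomialFunctions {c ℓ} (R : CommutativeRing c ℓ) where
  open CommutativeRing R hiding (zero)
  open ElementarySymmetric R using (e)
  open import Algebra.Properties.Semiring.Exp semiring using (_^_)
  open import Algebra.Properties.Group +-group using (//-rightDividesˡ) renaming (x∙y⁻¹≈ε⇒x≈y to x-y≈0⇒x≈y)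
  open import Algebra.Solver.Ring.NaturalCoefficients.Default commutativeSemiring
    using (solve; _:=_; _:+_; _:*_)
  open import Relation.Binary.Reasoning.Setoid setoid
  open SetoidUnique setoid using (Unique)

  -- Horner's scheme as a predicate on functions, so that degree bounds apply to expressions in z
  -- directly, without a separate type of polynomials.
  DegreeAtMost : ℕ → (Carrier → Carrier) → Set (c ⊔ ℓ)
  DegreeAtMost zero    f = ∃ λ a → ∀ z → f z ≈ a
  DegreeAtMost (suc d) f = ∃ λ a → ∃ λ g → DegreeAtMost d g × (∀ z → f z ≈ a + z * g z)

  degree-cong : ∀ d {f g} → (∀ z → g z ≈ f z) → DegreeAtMost d f → DegreeAtMost d g
  degree-cong zero    g≈f (a , f≈)          = a , λ z → trans (g≈f z) (f≈ z)
  degree-cong (suc d) g≈f (a , h , deg , f≈) = a , h , deg , λ z → trans (g≈f z) (f≈ z)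

  degree-const : ∀ d a → DegreeAtMost d (λ _ → a)
  degree-const zero    a = a , λ _ → refl
  degree-const (suc d) a = a , _ , degree-const d 0# , λ z →
    sym (trans (+-congˡ (zeroʳ z)) (+-identityʳ a))

  degree-suc : ∀ d {f} → DegreeAtMost d f → DegreeAtMost (suc d) f
  degree-suc zero    (a , f≈)          = a , _ , degree-const 0 0# , λ z →
    trans (f≈ z) (sym (trans (+-congˡ (zeroʳ z)) (+-identityʳ a)))
  degree-suc (suc d) (a , g , deg , f≈) = a , g , degree-suc d deg , f≈

  degree-+ : ∀ d {f g} → DegreeAtMost d f → DegreeAtMost d g → DegreeAtMost d (λ z → f z + g z)
  degree-+ zero    (a , f≈) (b , g≈) = a + b , λ z → +-cong (f≈ z) (g≈ z)
  degree-+ (suc d) (a , f′ , deg-f , f≈) (b , g′ , deg-g , g≈) =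
    a + b , _ , degree-+ d deg-f deg-g , λ z → trans (+-cong (f≈ z) (g≈ z))
      (solve 5 (λ a b z u v → a :+ z :* u :+ (b :+ z :* v) := a :+ b :+ z :* (u :+ v)) refl a b z (f′ z) (g′ z))

  degree-scale : ∀ d a {f} → DegreeAtMost d f → DegreeAtMost d (λ z → a * f z)
  degree-scale zero    a (b , f≈)          = a * b , λ z → *-congˡ (f≈ z)
  degree-scale (suc d) a (b , g , deg , f≈) = a * b , _ , degree-scale d a deg , λ z →
    trans (*-congˡ (f≈ z)) (solve 4 (λ a b z u → a :* (b :+ z :* u) := a :* b :+ z :* (a :* u)) refl a b z (g z))

  degree-shift : ∀ d {f} → DegreeAtMost d f → DegreeAtMost (suc d) (λ z → z * f z)
  degree-shift d deg = 0# , _ , deg , λ z → sym (+-identityˡ _)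

  degree-linear-* : ∀ d a b {f} → DegreeAtMost d f → DegreeAtMost (suc d) (λ z → (a + z * b) * f z)
  degree-linear-* d a b {f} deg = degree-cong (suc d)
    (λ z → solve 4 (λ a b z u → (a :+ z :* b) :* u := a :* u :+ z :* (b :* u)) refl a b z (f z))
    (degree-+ (suc d) (degree-suc d (degree-scale d a deg)) (degree-shift d (degree-scale d b deg)))

  degree-^ : ∀ d → DegreeAtMost d (_^ d)
  degree-^ zero    = 1# , λ _ → refl
  degree-^ (suc d) = degree-shift d (degree-^ d)

  -- Each step of the recursion for `e` that lowers the index contributes one linear factor a + z b.
  degree-e : ∀ (ps : List (Carrier × Carrier)) j →
             DegreeAtMost j (λ z → e (map (λ (a , b) → a + z * b) ps) j)
  degree-e ps             zero    = degree-const 0 1#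
  degree-e []             (suc j) = degree-const (suc j) 0#
  degree-e ((a , b) ∷ ps) (suc j) = degree-+ (suc j) (degree-e ps (suc j)) (degree-linear-* j a b (degree-e ps j))

  z≈r+[z-r] : ∀ z r → z ≈ r + (z - r)
  z≈r+[z-r] z r = trans (sym (//-rightDividesˡ r z)) (+-comm _ _)

  -- Division by z - r with remainder f r, one Horner step at a time: if g = g r + (z - r) h, then a
  -- + z g has the quotient g + r h.
  degree-factor : ∀ d {f} r → DegreeAtMost (suc d) f →
                  ∃ λ g → DegreeAtMost d g × (∀ z → f z ≈ f r + (z - r) * g z)
  degree-factor zero {f} r (a , g , (b , g≈b) , f≈) = (λ _ → b) , (b , λ _ → refl) , λ z → begin
    f z                          ≈⟨ trans (f≈ z) (+-congˡ (*-congˡ (g≈b z))) ⟩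
    a + z * b                    ≈⟨ +-congˡ (*-congʳ (z≈r+[z-r] z r)) ⟩
    a + (r + (z - r)) * b        ≈⟨ solve 4 (λ a r t b → a :+ (r :+ t) :* b := a :+ r :* b :+ t :* b) refl a r (z - r) b ⟩
    a + r * b + (z - r) * b      ≈⟨ +-congʳ (trans (f≈ r) (+-congˡ (*-congˡ (g≈b r)))) ⟨
    f r + (z - r) * b            ∎
  degree-factor (suc d) {f} r (a , g , deg , f≈)
    with h , deg-h , g≈ ← degree-factor d r deg =
    _ , degree-+ (suc d) deg (degree-suc d (degree-scale d r deg-h)) , λ z → begin
    f z                          ≈⟨ f≈ z ⟩
    a + z * g z                  ≈⟨ +-congˡ (*-congʳ (z≈r+[z-r] z r)) ⟩
    a + (r + (z - r)) * g z
      ≈⟨ solve 4 (λ a r t u → a :+ (r :+ t) :* u := a :+ t :* u :+ r :* u) refl a r (z - r) (g z) ⟩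
    a + (z - r) * g z + r * g z  ≈⟨ +-congˡ (*-congˡ (g≈ z)) ⟩
    a + (z - r) * g z + r * (g r + (z - r) * h z)
      ≈⟨ solve 6 (λ a r t u v w → a :+ t :* u :+ r :* (v :+ t :* w) := a :+ r :* v :+ t :* (u :+ r :* w)) refl
           a r (z - r) (g z) (g r) (h z) ⟩
    a + r * g r + (z - r) * (g z + r * h z)   ≈⟨ +-congʳ (f≈ r) ⟨
    f r + (z - r) * (g z + r * h z)           ∎

  -- Dividing by one root lowers the degree bound, and by `cancel` the other roots are roots of the
  -- quotient. The conclusion will be evaluated at 0, which need not be among the given roots.
  too-many-roots : (∀ x y → ¬ x ≈ 0# → x * y ≈ 0# → y ≈ 0#) →
                   ∀ d {f} → DegreeAtMost d f → ∀ {zs} → Unique zs → All (λ z → f z ≈ 0#) zs →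
                   d ℕ.< length zs → ∀ y → f y ≈ 0#
  too-many-roots cancel zero    (a , f≈a) _ (fz≈0 ∷ _) _ y = trans (f≈a y) (trans (sym (f≈a _)) fz≈0)
  too-many-roots cancel (suc d) {f} deg {r ∷ zs} (r≉zs ∷ zs!) (fr≈0 ∷ fzs≈0) (ℕ.s≤s d<|zs|) y
    with g , deg-g , f≈ ← degree-factor d r deg = begin
    f y                  ≈⟨ f≈ y ⟩
    f r + (y - r) * g y  ≈⟨ +-cong fr≈0 (*-congˡ (too-many-roots cancel d deg-g zs! roots d<|zs| y)) ⟩
    0# + (y - r) * 0#    ≈⟨ trans (+-identityˡ _) (zeroʳ _) ⟩
    0#                   ∎
    where
    root : ∀ {z} → ¬ r ≈ z → f z ≈ 0# → g z ≈ 0#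
    root {z} r≉z fz≈0 = cancel (z - r) (g z) (λ z-r≈0 → r≉z (sym (x-y≈0⇒x≈y z r z-r≈0))) (begin
      (z - r) * g z         ≈⟨ +-identityˡ _ ⟨
      0# + (z - r) * g z    ≈⟨ +-congʳ fr≈0 ⟨
      f r + (z - r) * g z   ≈⟨ f≈ z ⟨
      f z                   ≈⟨ fz≈0 ⟩
      0#                    ∎)
    roots : All (λ z → g z ≈ 0#) zs
    roots = All.zipWith (λ (r≉z , fz≈0) → root r≉z fz≈0) (r≉zs , fzs≈0)

-- Listing finite subsets, and a numerical bound

length-cartesianProduct : ∀ {a b} {A : Set a} {B : Set b} (xs : List A) (ys : List B) →
                          length (cartesianProduct xs ys) ≡ length xs ℕ.* length ys
length-cartesianProduct []       ys = ≡.refl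
length-cartesianProduct (x ∷ xs) ys = ≡.trans (length-++ (map (x ,_) ys))
  (≡.cong₂ ℕ._+_ (length-map (x ,_) ys) (length-cartesianProduct xs ys))

members : ∀ {n} → Subset n → List (Fin n)
members []            = []
members (inside  ∷ p) = Fin.zero ∷ map Fin.suc (members p)
members (outside ∷ p) = map Fin.suc (members p)

length-members : ∀ {n} (p : Subset n) → length (members p) ≡ ∣ p ∣
length-members []            = ≡.refl
length-members (inside  ∷ p) = ≡.cong suc (≡.trans (length-map Fin.suc (members p)) (length-members p))
length-members (outside ∷ p) = ≡.trans (length-map Fin.suc (members p)) (length-members p)

unique-members : ∀ {n} (p : Subset n) → SetoidUnique.Unique (≡.setoid (Fin n)) (members p)
unique-members []            = []
unique-members (inside  ∷ p) = All.map⁺ (All.universal (λ _ ()) _) ∷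
  Unique.map⁺ (≡.setoid _) (≡.setoid _) Fin.suc-injective (unique-members p)
unique-members (outside ∷ p) = Unique.map⁺ (≡.setoid _) (≡.setoid _) Fin.suc-injective (unique-members p)

∈-members⁺ : ∀ {n} {p : Subset n} {i} → i Sub.∈ p → i Prop.∈ members p
∈-members⁺ {p = inside  ∷ p} here        = here ≡.refl
∈-members⁺ {p = inside  ∷ p} (there i∈p) = there (Prop.∈-map⁺ Fin.suc (∈-members⁺ i∈p))
∈-members⁺ {p = outside ∷ p} (there i∈p) = Prop.∈-map⁺ Fin.suc (∈-members⁺ i∈p)

all-members : ∀ {n} (p : Subset n) → All (Sub._∈ p) (members p)
all-members []            = []
all-members (inside  ∷ p) = here ∷ All.map⁺ (All.map there (all-members p))
all-members (outside ∷ p) = All.map⁺ (All.map there (all-members p))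

-- With q = m + 1, the bounds give q² - 1 ≤ 2 G ≤ m q = q² - q. So for q > 1 one of the
-- complementary indices j and k has its multiple by q below G.
halves-too-small : ∀ {G} m j k → j ℕ.+ k ≡ m → suc m ℕ.* suc m ℕ.≤ 2 ℕ.* G ℕ.+ 1 →
                   G ℕ.≤ j ℕ.* suc m → G ℕ.≤ k ℕ.* suc m → m ℕ.≤ 0
halves-too-small {G} m j k j+k≡m q²≤2G+1 G≤jq G≤kq = ℕ.s≤s⁻¹ (ℕ.+-cancelʳ-≤ (m ℕ.* suc m) (suc m) 1 (begin
  suc m ℕ.* suc m                        ≤⟨ q²≤2G+1 ⟩
  2 ℕ.* G ℕ.+ 1                          ≡⟨ ℕ.+-comm (2 ℕ.* G) 1 ⟩
  1 ℕ.+ (G ℕ.+ (G ℕ.+ 0))                ≡⟨ ≡.cong (λ g → 1 ℕ.+ (G ℕ.+ g)) (ℕ.+-identityʳ G) ⟩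
  1 ℕ.+ (G ℕ.+ G)                        ≤⟨ ℕ.+-monoʳ-≤ 1 (ℕ.+-mono-≤ G≤jq G≤kq) ⟩
  1 ℕ.+ (j ℕ.* suc m ℕ.+ k ℕ.* suc m)    ≡⟨ ≡.cong suc (ℕ.*-distribʳ-+ (suc m) j k) ⟨
  1 ℕ.+ (j ℕ.+ k) ℕ.* suc m              ≡⟨ ≡.cong (λ i → 1 ℕ.+ i ℕ.* suc m) j+k≡m ⟩
  1 ℕ.+ m ℕ.* suc m                      ∎))
  where open ℕ.≤-Reasoning

-- Finite fields: inverses, characteristic, symmetric functions of tilings

module FiniteFieldProperties {c ℓ₁ ℓ₂ n} (F : FiniteField c ℓ₁ ℓ₂ n) where
  open FiniteField F using (enumeration; index; element; heytingCommutativeRing; tight; #-irrefl; #⇒invertible; invertible⇒#)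

  R : CommutativeRing c ℓ₁
  R = HeytingCommutativeRing.commutativeRing heytingCommutativeRing

  open CommutativeRing R hiding (zero)
  open import Algebra.Properties.Semiring.Exp semiring using (_^_; ^-congˡ)
  open import Algebra.Properties.Semiring.Mult semiring
    using (×-congˡ; ×-congʳ; ×1-homo-*; ×-assoc-*) renaming (_×_ to _·_)
  open import Algebra.Properties.CommutativeSemiring.Exp commutativeSemiring using (^-distrib-*)
  open import Algebra.Properties.Group +-group using (∙-cancelˡ; ∙-cancelʳ; ε⁻¹≈ε; //-rightDividesʳ)
    renaming (x∙y⁻¹≈ε⇒x≈y to x-y≈0⇒x≈y; x≈y⇒x∙y⁻¹≈ε to x≈y⇒x-y≈0)
  open import Algebra.Properties.Ring ring using (x[y-z]≈xy-xz; -1*x≈-x)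
  open import Algebra.Solver.Ring.NaturalCoefficients.Default commutativeSemiring
    using (solve; _:=_; _:+_; _:*_)
  open import Relation.Binary.Reasoning.Setoid setoid
  open SetoidMembership setoid using () renaming (_∈_ to _∈ₗ_)
  open SetoidUnique setoid using (Unique)
  open UniqueLists setoid
  open ElementarySymmetric R hiding (module ↭)
  open PolynomialFunctions R
  open ↭ using (_↭_)
  open SetoidPermutationProperties setoid using (Unique-resp-↭; ∈-resp-↭; xs↭ys⇒|xs|≡|ys|)

  index-cong : ∀ {x y} → x ≈ y → index x ≡ index y
  index-cong = Inverse.to-cong enumeration

  index-element : ∀ i → index (element i) ≡ i
  index-element = Inverse.strictlyInverseˡ enumeration

  element-index : ∀ x → element (index x) ≈ x
  element-index = Inverse.strictlyInverseʳ enumeration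

  index-injective : ∀ {x y} → index x ≡ index y → x ≈ y
  index-injective {x} {y} eq = trans (sym (element-index x)) (trans (Inverse.from-cong enumeration eq) (element-index y))

  element-injective : ∀ {i j} → element i ≈ element j → i ≡ j
  element-injective {i} {j} eq = ≡.trans (≡.sym (index-element i)) (≡.trans (index-cong eq) (index-element j))

  infix 4 _≟_
  _≟_ : Binary.Decidable _≈_
  x ≟ y = map′ index-injective index-cong (index x Fin.≟ index y)

  x-0≈x : ∀ x → x - 0# ≈ x
  x-0≈x x = trans (+-congˡ ε⁻¹≈ε) (+-identityʳ x)

  -- The difference 1 - 0 is invertible, so the Heyting axioms make 1 apart from 0.
  1≉0 : ¬ 1# ≈ 0#
  1≉0 1≈0 = #-irrefl 1≈0 (invertible⇒# (1# , trans (*-identityˡ _) (x-0≈x 1#) , trans (*-identityʳ _) (x-0≈x 1#)))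

  hasInverse? : ∀ x → Dec (∃ λ i → x * element i ≈ 1#)
  hasInverse? x = Fin.any? λ i → x * element i ≟ 1#

  inv : Carrier → Carrier
  inv x with hasInverse? x
  ... | yes (i , _) = element i
  -- A default value, reached only at 0.
  ... | no  _       = 0#

  inverseʳ : ∀ {x} → ¬ x ≈ 0# → x * inv x ≈ 1#
  inverseʳ {x} x≉0 with hasInverse? x
  ... | yes (i , x*i≈1) = x*i≈1
  -- Without an inverse, x could not be apart from 0, and tightness would make it equal to 0.
  ... | no  ∄inverse    = contradiction (proj₁ (tight x 0#) λ x#0 →
      let y , _ , x*y≈1 = #⇒invertible x#0
      in ∄inverse (index y , trans (*-cong (sym (x-0≈x x)) (element-index y)) x*y≈1)) x≉0

  *-cancelˡ : ∀ {x y z} → ¬ x ≈ 0# → x * y ≈ x * z → y ≈ z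
  *-cancelˡ {x} {y} {z} x≉0 xy≈xz = begin
    y                  ≈⟨ unit y ⟩
    inv x * (x * y)    ≈⟨ *-congˡ xy≈xz ⟩
    inv x * (x * z)    ≈⟨ unit z ⟨
    z                  ∎
    where
    unit : ∀ y → y ≈ inv x * (x * y)
    unit y = begin
      y                  ≈⟨ *-identityˡ y ⟨
      1# * y             ≈⟨ *-congʳ (inverseʳ x≉0) ⟨
      x * inv x * y      ≈⟨ solve 3 (λ x x′ y → x :* x′ :* y := x′ :* (x :* y)) refl x (inv x) y ⟩
      inv x * (x * y)    ∎

  *-cancel-0 : ∀ x y → ¬ x ≈ 0# → x * y ≈ 0# → y ≈ 0#
  *-cancel-0 x y x≉0 xy≈0 = *-cancelˡ x≉0 (trans xy≈0 (sym (zeroʳ x)))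

  *-≉0 : ∀ {x y} → ¬ x ≈ 0# → ¬ y ≈ 0# → ¬ x * y ≈ 0#
  *-≉0 x≉0 y≉0 xy≈0 = y≉0 (*-cancel-0 _ _ x≉0 xy≈0)

  ^-≉0 : ∀ {x} q → ¬ x ≈ 0# → ¬ x ^ q ≈ 0#
  ^-≉0 zero    x≉0 = 1≉0
  ^-≉0 (suc q) x≉0 = *-≉0 x≉0 (^-≉0 q x≉0)

  ^-≈0 : ∀ {x} q → x ^ q ≈ 0# → x ≈ 0#
  ^-≈0 {x} q x^q≈0 with x ≟ 0#
  ... | yes x≈0 = x≈0
  ... | no  x≉0 = contradiction x^q≈0 (^-≉0 q x≉0)

  elements : List Carrier
  elements = map element (allFin n)

  length-elements : length elements ≡ n
  length-elements = ≡.trans (length-map element (allFin n)) (length-tabulate {n = n} (λ i → i))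

  ∈-elements : ∀ x → x ∈ₗ elements
  ∈-elements x = Membership.∈-resp-≈ setoid (element-index x)
    (Membership.∈-map⁺ (≡.setoid (Fin n)) setoid (Inverse.from-cong enumeration) (Prop.∈-allFin (index x)))

  unique-elements : Unique elements
  unique-elements = Unique.map⁺ (≡.setoid (Fin n)) setoid element-injective
    (Unique.tabulate⁺ (≡.setoid (Fin n)) (λ eq → eq))

  ↭-elements : ∀ {xs} → Unique xs → length xs ≡ n → xs ↭ elements
  ↭-elements xs! |xs|≡n = unique⇒↭ xs! (All.universal ∈-elements _)
    (ℕ.≤-reflexive (≡.trans length-elements (≡.sym |xs|≡n)))

  -- Adding 1 to every element permutes the field, so the sum of all elements is unchanged; yet it
  -- grows by `n · 1#`.
  n·1≈0 : n · 1# ≈ 0#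
  n·1≈0 = ∙-cancelˡ (e elements 1) (n · 1#) 0# (begin
    e elements 1 + n · 1#                  ≈⟨ +-congˡ (×-congˡ length-elements) ⟨
    e elements 1 + length elements · 1#    ≈⟨ e₁-translate 1# elements ⟨
    e (map (1# +_) elements) 1             ≈⟨ e-↭ translated 1 ⟩
    e elements 1                           ≈⟨ +-identityʳ _ ⟨
    e elements 1 + 0#                      ∎)
    where
    translated : map (1# +_) elements ↭ elements
    translated = ↭-elements (Unique.map⁺ setoid setoid (∙-cancelˡ 1# _ _) unique-elements)
                            (≡.trans (length-map (1# +_) elements) length-elements)

  m·x≈m·1*x : ∀ m x → m · x ≈ (m · 1#) * x
  m·x≈m·1*x m x = sym (trans (×-assoc-* m 1# x) (×-congʳ m (*-identityˡ x)))

  -- `(p ℕ.^ k) · 1#` is the k-th power of `p · 1#`, and there are no zero divisors.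
  p^k·1≈0⇒p·1≈0 : ∀ p k → (p ℕ.^ k) · 1# ≈ 0# → p · 1# ≈ 0#
  p^k·1≈0⇒p·1≈0 p zero    1≈0 = contradiction (trans (sym (+-identityʳ 1#)) 1≈0) 1≉0
  p^k·1≈0⇒p·1≈0 p (suc k) eq with p · 1# ≟ 0#
  ... | yes p·1≈0 = p·1≈0
  ... | no  p·1≉0 = p^k·1≈0⇒p·1≈0 p k (*-cancel-0 _ _ p·1≉0 (trans (sym (×1-homo-* p (p ℕ.^ k))) eq))

  -- Scaling by a nonzero z permutes the field, so e j of the multiples z x minus e j of the field,
  -- a polynomial of degree ≤ j in z, has more than j roots. Hence it also vanishes at z = 0, where
  -- all the multiples are 0.
  e-elements : ∀ {zs} → Unique zs → All (λ z → ¬ z ≈ 0#) zs →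
               ∀ {j} → 0 ℕ.< j → j ℕ.< length zs → e elements j ≈ 0#
  e-elements {zs} zs! zs≉0 {j@(suc i)} _ j<|zs| = begin
    e elements j   ≈⟨ x-y≈0⇒x≈y _ _ (too-many-roots *-cancel-0 j degree zs! (All.map root zs≉0) j<|zs| 0#) ⟨
    e (L 0#) j     ≈⟨ e-zeros (L 0#) (All.map⁺ (All.map⁺ (All.universal (λ x → trans (+-identityˡ _) (zeroˡ x)) elements))) i ⟩
    0#             ∎
    where
    L : Carrier → List Carrier
    -- The entries are written 0 + z x to have the shape that `degree-e` expects.
    L z = map (λ (a , b) → a + z * b) (map (0# ,_) elements)
    degree : DegreeAtMost j (λ z → e (L z) j - e elements j)
    degree = degree-+ j (degree-e (map (0# ,_) elements) j) (degree-const j _)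
    L≡ : ∀ z → L z ≡ map (λ x → 0# + z * x) elements
    L≡ z = ≡.sym (map-∘ elements)
    scaled : ∀ {z} → ¬ z ≈ 0# → map (λ x → 0# + z * x) elements ↭ elements
    scaled z≉0 = ↭-elements
      (Unique.map⁺ setoid setoid (λ eq → *-cancelˡ z≉0 (∙-cancelˡ 0# _ _ eq)) unique-elements)
      (≡.trans (length-map _ elements) length-elements)
    root : ∀ {z} → ¬ z ≈ 0# → e (L z) j - e elements j ≈ 0#
    root {z} z≉0 = x≈y⇒x-y≈0 (trans (reflexive (≡.cong (λ xs → e xs j) (L≡ z))) (e-↭ (scaled z≉0) j))

  -- For z in `zs` a coincidence a + z c = a′ + z c′ with c ≠ c′ is excluded, so the sums are
  -- distinct and, being n in number, fill the field. By `e-elements` their e j is then 0; with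
  -- degree ≤ j in z and more than j roots it is 0 at z = 0 too, where only copies of `xs` remain.
  e-copies : ∀ {xs ys zs} → Unique xs → Unique ys → length xs ℕ.* length ys ≡ n →
             Unique zs → All (λ z → ¬ z ≈ 0#) zs →
             All (λ z → ∀ {a a′ c c′} → a ∈ₗ xs → a′ ∈ₗ xs → c ∈ₗ ys → c′ ∈ₗ ys → ¬ c ≈ c′ →
                        ¬ a - a′ ≈ z * (c - c′)) zs →
             ∀ {j} → 0 ℕ.< j → j ℕ.< length zs → e (concatMap (replicate (length ys)) xs) j ≈ 0#
  e-copies {xs} {ys} {zs} xs! ys! |xs|*|ys|≡n zs! zs≉0 tiling {j} 0<j j<|zs| = begin
    e (concatMap (replicate (length ys)) xs) j  ≈⟨ e-pointwise (at-0 xs) j ⟨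
    e (L 0#) j
      ≈⟨ too-many-roots *-cancel-0 j (degree-e pairs j) zs! (All.zipWith root (zs≉0 , tiling)) j<|zs| 0# ⟩
    0#                                          ∎
    where
    pairs : List (Carrier × Carrier)
    pairs = cartesianProduct xs ys
    evaluate : Carrier → Carrier × Carrier → Carrier
    evaluate z (a , c) = a + z * c
    L : Carrier → List Carrier
    L z = map (evaluate z) pairs

    constant : ∀ a cs → Pointwise _≈_ (map (evaluate 0#) (map (a ,_) cs)) (replicate (length cs) a)
    constant a []       = []
    constant a (c ∷ cs) = trans (+-congˡ (zeroˡ c)) (+-identityʳ a) ∷ constant a cs

    at-0 : ∀ as → Pointwise _≈_ (map (evaluate 0#) (cartesianProduct as ys)) (concatMap (replicate (length ys)) as)
    at-0 []       = []
    at-0 (a ∷ as) = ≡.subst (λ bs → Pointwise _≈_ bs (replicate (length ys) a ++ concatMap (replicate (length ys)) as))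
      (≡.sym (map-++ (evaluate 0#) (map (a ,_) ys) (cartesianProduct as ys)))
      (Pointwise.++⁺ (constant a ys) (at-0 as))

    rearrange : ∀ {a a′ u v} → a + u ≈ a′ + v → a - a′ ≈ v - u
    rearrange {a} {a′} {u} {v} eq = begin
      a - a′               ≈⟨ +-congʳ (//-rightDividesʳ u a) ⟨
      a + u - u - a′       ≈⟨ +-congʳ (+-congʳ eq) ⟩
      a′ + v - u - a′      ≈⟨ solve 4 (λ a′ v s t → a′ :+ v :+ s :+ t := (v :+ s) :+ (a′ :+ t)) refl a′ v (- u) (- a′) ⟩
      v - u + (a′ - a′)    ≈⟨ trans (+-congˡ (-‿inverseʳ a′)) (+-identityʳ _) ⟩
      v - u                ∎

    root : ∀ {z} → (¬ z ≈ 0#) × (∀ {a a′ c c′} → a ∈ₗ xs → a′ ∈ₗ xs → c ∈ₗ ys → c′ ∈ₗ ys → ¬ c ≈ c′ →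
                        ¬ a - a′ ≈ z * (c - c′)) → e (L z) j ≈ 0#
    root {z} (z≉0 , separated) = trans (e-↭ tile j) (e-elements zs! zs≉0 0<j j<|zs|)
      where
      injective : ∀ {p p′ : Carrier × Carrier} → proj₁ p ∈ₗ xs × proj₂ p ∈ₗ ys → proj₁ p′ ∈ₗ xs × proj₂ p′ ∈ₗ ys →
                  evaluate z p ≈ evaluate z p′ → proj₁ p ≈ proj₁ p′ × proj₂ p ≈ proj₂ p′
      injective {a , c} {a′ , c′} (a∈ , c∈) (a′∈ , c′∈) eq with c ≟ c′
      ... | yes c≈c′ = ∙-cancelʳ (z * c) a a′ (trans eq (+-congˡ (*-congˡ (sym c≈c′)))) , c≈c′
      ... | no  c≉c′ = contradiction
        (trans (rearrange eq) (sym (x[y-z]≈xy-xz z c′ c)))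
        (separated a∈ a′∈ c′∈ c∈ (c≉c′ ∘ sym))
      tile : L z ↭ elements
      tile = ↭-elements
        (unique-map-on (setoid ×ₛ setoid) setoid injective
          (All.cartesianProduct⁺ setoid setoid xs ys _,_)
          (Unique.cartesianProduct⁺ setoid setoid xs! ys!))
        (≡.trans (length-map (evaluate z) pairs) (≡.trans (length-cartesianProduct xs ys) |xs|*|ys|≡n))

  module _ {p} (p-prime : Prime p) (p·1≈0 : p · 1# ≈ 0#) (k : ℕ) where
    private
      q = p ℕ.^ k

      0<q : 0 ℕ.< q
      0<q = ℕ.m^n>0 p {{prime⇒nonZero p-prime}} k

    binomial-vanishes : ∀ {j} → 0 ℕ.< j → j ℕ.< q → ∀ x → (q C j) · x ≈ 0#
    binomial-vanishes {j} 0<j j<q x with p∣p^kCj p-prime k 0<j j<q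
    ... | divides r eq = begin
      (q C j) · x                  ≈⟨ ×-congˡ eq ⟩
      (r ℕ.* p) · x                ≈⟨ m·x≈m·1*x (r ℕ.* p) x ⟩
      ((r ℕ.* p) · 1#) * x         ≈⟨ *-congʳ (×1-homo-* r p) ⟩
      (r · 1#) * (p · 1#) * x      ≈⟨ *-congʳ (trans (*-congˡ p·1≈0) (zeroʳ _)) ⟩
      0# * x                       ≈⟨ zeroˡ x ⟩
      0#                           ∎

    -- By Frobenius the given value is the q-th power of `e xs i`, and a field has no nilpotents.
    e-of-copies≈0 : ∀ xs i → e (concatMap (replicate q) xs) (i ℕ.* q) ≈ 0# → e xs i ≈ 0#
    e-of-copies≈0 xs i eq = ^-≈0 q (begin
      e xs i ^ q                                ≈⟨ FrobeniusExponent.e-map-^q q 0<q binomial-vanishes xs i ⟨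
      e (map (_^ q) xs) i                       ≈⟨ FrobeniusExponent.e-concatMap-replicate q 0<q binomial-vanishes xs i ⟨
      e (concatMap (replicate q) xs) (i ℕ.* q)  ≈⟨ eq ⟩
      0#                                        ∎)

  -- The top value is the product of the entries.
  e-top≉0 : ∀ {xs} → All (λ x → ¬ x ≈ 0#) xs → ¬ e xs (length xs) ≈ 0#
  e-top≉0 []             = 1≉0
  e-top≉0 {x ∷ xs} (x≉0 ∷ xs≉0) eq = *-≉0 x≉0 (e-top≉0 xs≉0)
    (trans (sym (trans (+-congʳ (e-beyond xs ℕ.≤-refl)) (+-identityˡ _))) eq)

  -- Multiplication by x permutes `xs`, so the product of the entries equals itself times x ^ m and
  -- can be cancelled.
  fermat : ∀ {xs} → Unique xs → All (λ x → ¬ x ≈ 0#) xs → ∀ {x} → ¬ x ≈ 0# →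
           All (λ y → x * y ∈ₗ xs) xs → x ^ length xs ≈ 1#
  fermat {xs} xs! xs≉0 {x} x≉0 closed = *-cancelˡ (e-top≉0 xs≉0) (begin
    e xs m * x ^ m        ≈⟨ *-comm _ _ ⟩
    x ^ m * e xs m        ≈⟨ e-scale x xs m ⟨
    e (map (x *_) xs) m   ≈⟨ e-↭ (unique⇒↭ (Unique.map⁺ setoid setoid (*-cancelˡ x≉0) xs!) (All.map⁺ closed)
                                   (ℕ.≤-reflexive (≡.sym (length-map (x *_) xs)))) m ⟩
    e xs m                ≈⟨ *-identityʳ _ ⟨
    e xs m * 1#           ∎)
    where m = length xs

  -- Up to sign ∏ (X - a) is κ X ^ m + E. A further root x outside `xs` would give it m + 1 roots at
  -- degree m, so its value E at 0 would vanish; but E is a product of nonzero entries.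
  contains-roots-of-unity : ∀ {xs} → Unique xs → All (λ x → ¬ x ≈ 0#) xs → 1# ∈ₗ xs →
    (∀ j → 0 ℕ.< j → j ℕ.< length xs → e xs j ≈ 0#) → 0 ℕ.< length xs →
    ∀ {x} → x ^ length xs ≈ 1# → ¬ (∀ {y} → y ∈ₗ xs → ¬ x ≈ y)
  contains-roots-of-unity {xs} xs! xs≉0 1∈xs inner 0<m {x} x^m≈1 x∉xs =
    e-top≉0 xs≉0 (begin
      E               ≈⟨ trans (+-congʳ (trans (*-congˡ (0^n≈0 0<m)) (zeroʳ κ))) (+-identityˡ E) ⟨
      κ * 0# ^ m + E  ≈⟨ too-many-roots *-cancel-0 m (degree-+ m (degree-scale m κ (degree-^ m)) (degree-const m E))
                           {x ∷ xs} (All.tabulateₛ setoid x∉xs ∷ xs!) (root-x ∷ All.tabulateₛ setoid root) ℕ.≤-refl 0# ⟩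
      0#              ∎)
    where
    m = length xs
    E = e xs m
    -- The sign comes from `e-delete`, which gives E = - (- a) ^ m for every entry a.
    κ = (- 1#) ^ m
    root : ∀ {a} → a ∈ₗ xs → κ * a ^ m + E ≈ 0#
    root {a} a∈xs with as , a∷as↭xs ← ∈⇒∃↭ a∈xs = begin
      κ * a ^ m + E                     ≈⟨ +-cong (^-distrib-* (- 1#) a m) (e-↭ a∷as↭xs m) ⟨
      (- 1# * a) ^ m + e (a ∷ as) m
        ≈⟨ +-cong (^-congˡ m (-1*x≈-x a)) (top as (xs↭ys⇒|xs|≡|ys| a∷as↭xs)
                                            (λ j 0<j j<m → trans (e-↭ a∷as↭xs j) (inner j 0<j j<m))) ⟩
      (- a) ^ m - (- a) ^ m             ≈⟨ -‿inverseʳ _ ⟩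
      0#                                ∎
      where
      top : ∀ as → length (a ∷ as) ≡ m → (∀ j → 0 ℕ.< j → j ℕ.< m → e (a ∷ as) j ≈ 0#) → e (a ∷ as) m ≈ - ((- a) ^ m)
      top as eq vanish rewrite ≡.sym eq = e-delete a as vanish
    -- Since x ^ m = 1 = 1 ^ m, the polynomial takes the same value at x as at the entry 1.
    root-x : κ * x ^ m + E ≈ 0#
    root-x = trans (+-congʳ (*-congˡ (trans x^m≈1 (sym (1^n≈1 m))))) (root 1∈xs)

  -- A list without repetitions contains 0 at most once, so at most one entry is lost. The result
  -- will serve as the set Z.
  remove-0 : ∀ {xs} → Unique xs → ∃ λ ys → Unique ys × All (λ y → ¬ y ≈ 0# × y ∈ₗ xs) ys × length xs ℕ.≤ suc (length ys)
  remove-0 {xs} xs! with any? (0# ≟_) xs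
  ... | no 0∉xs = xs , xs! ,
    All.tabulateₛ setoid (λ {y} y∈xs → (λ y≈0 → 0∉xs (Membership.∈-resp-≈ setoid y≈0 y∈xs)) , y∈xs) ,
    ℕ.n≤1+n _
  ... | yes 0∈xs with ys , 0∷ys↭xs ← ∈⇒∃↭ 0∈xs with 0≉ys ∷ ys! ← Unique-resp-↭ (↭.↭-sym 0∷ys↭xs) xs! =
    ys , ys! ,
    All.zipWith (λ (0≉y , y∈ys) → (0≉y ∘ sym) , ∈-resp-↭ 0∷ys↭xs (there y∈ys)) (0≉ys , All.tabulateₛ setoid (λ y∈ys → y∈ys)) ,
    ℕ.≤-reflexive (≡.sym (xs↭ys⇒|xs|≡|ys| 0∷ys↭xs))

  -- Here q = `suc (length xs)` and G stands for the size of Z. By `halves-too-small` every inner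
  -- index j is reached either by `low`, or by `low-inv` at the complementary index after the
  -- reversal of `e-inverses`; the 0 in front does not affect `e`.
  inner-vanish : ∀ {xs G} → All (λ x → ¬ x ≈ 0#) xs → suc (length xs) ℕ.* suc (length xs) ℕ.≤ 2 ℕ.* G ℕ.+ 1 →
    (∀ i → 0 ℕ.< i → i ℕ.* suc (length xs) ℕ.< G → e (0# ∷ xs) i ≈ 0#) →
    (∀ i → 0 ℕ.< i → i ℕ.* suc (length xs) ℕ.< G → e (0# ∷ map inv xs) i ≈ 0#) →
    ∀ j → 0 ℕ.< j → j ℕ.< length xs → e xs j ≈ 0#
  inner-vanish {xs} {G} xs≉0 q²≤2G+1 low low-inv j 0<j j<m
    with j ℕ.* suc (length xs) ℕ.<? G | (length xs ℕ.∸ j) ℕ.* suc (length xs) ℕ.<? G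
  ... | yes jq<G | _ = trans (sym (e-0∷ xs j)) (low j 0<j jq<G)
  ... | no _ | yes kq<G = trans (e-inverses inv xs (All.map inverseʳ xs≉0) j k j+k≡m)
      (trans (*-congˡ (trans (sym (e-0∷ _ k)) (low-inv k (ℕ.m<n⇒0<n∸m j<m) kq<G))) (zeroʳ _))
    where
    k = length xs ℕ.∸ j
    j+k≡m : j ℕ.+ k ≡ length xs
    j+k≡m = ℕ.m+[n∸m]≡n (ℕ.<⇒≤ j<m)
  ... | no jq≮G | no kq≮G = contradiction
    (halves-too-small (length xs) j (length xs ℕ.∸ j) (ℕ.m+[n∸m]≡n (ℕ.<⇒≤ j<m)) q²≤2G+1 (ℕ.≮⇒≥ jq≮G) (ℕ.≮⇒≥ kq≮G))
    (ℕ.<⇒≱ (ℕ.<-trans 0<j j<m))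

-- Subsets of the field and their product sets

∈-tabulate⁺ : ∀ {n p} {P : Fin n → Set p} (P? : Decidable P) {i} → P i → i Sub.∈ tabulate (does ∘ P?)
∈-tabulate⁺ P? {i} pi = lookup⇒[]= i _ (≡.trans (lookup∘tabulate (does ∘ P?) i) (dec-true (P? i) pi))

⊆∧∣∣≡⇒≡ : ∀ {n} {p q : Subset n} → p ⊆ q → ∣ p ∣ ≡ ∣ q ∣ → p ≡ q
⊆∧∣∣≡⇒≡ {p = p} {q} p⊆q ∣p∣≡∣q∣ = Sub.⊆-antisym p⊆q λ {x} x∈q →
  decidable-stable (x Sub.∈? p) λ x∉p → ℕ.<⇒≢ (Sub.p⊂q⇒∣p∣<∣q∣ (p⊆q , x , x∈q , x∉p)) ∣p∣≡∣q∣

module SubsetProperties {c ℓ₁ ℓ₂ n} (F : FiniteField c ℓ₁ ℓ₂ n) where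
  open FiniteField F using (index; element)
  open FiniteFieldProperties F
  open CommutativeRing R hiding (zero; 0#; 1#)
  open SubsetsOf F
  open SetoidMembership setoid using () renaming (_∈_ to _∈ₗ_)
  open SetoidUnique setoid using (Unique)

  ∈-resp-≈ : ∀ {x y} {A : Subset n} → x ≈ y → x ∈ A → y ∈ A
  ∈-resp-≈ {A = A} x≈y = ≡.subst (Sub._∈ A) (index-cong x≈y)

  ∈-image₂ : ∀ (_∙_ : Carrier → Carrier → Carrier) → (∀ {x y u v} → x ≈ y → u ≈ v → x ∙ u ≈ y ∙ v) →
             ∀ {x y} {A B : Subset n} → x ∈ A → y ∈ B → (x ∙ y) ∈ image₂ _∙_ A B
  ∈-image₂ _∙_ ∙-cong {x} {y} {A} {B} x∈A y∈B = ∈-tabulate⁺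
    -- The decision procedure repeats the body of `image₂` so that the two tabulations agree by
    -- definition.
    (λ i → Fin.any? λ j → Fin.any? λ k → (j Sub.∈? A) ×-dec (k Sub.∈? B) ×-dec (index (element j ∙ element k) Fin.≟ i))
    (index x , index y , x∈A , y∈B , index-cong (∙-cong (element-index x) (element-index y)))

  ∈-⊛ : ∀ {x y} {A B : Subset n} → x ∈ A → y ∈ B → x * y ∈ A ⊛ B
  ∈-⊛ = ∈-image₂ _*_ *-cong

  ∈-⊖ : ∀ {x y} {A B : Subset n} → x ∈ A → y ∈ B → x - y ∈ A ⊖ B
  ∈-⊖ = ∈-image₂ _-_ (λ x≈y u≈v → +-cong x≈y (-‿cong u≈v))

  ∈-⁻¹ : ∀ {x y} {A : Subset n} → x ∈ A → x * y ≈ 1# → y ∈ A ⁻¹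
  ∈-⁻¹ {x} {y} {A} x∈A xy≈1 = ∈-tabulate⁺
    (λ i → Fin.any? λ j → (j Sub.∈? A) ×-dec (index (element j * element i) Fin.≟ index 1#))
    (index x , x∈A , index-cong (trans (*-cong (element-index x) (element-index y)) xy≈1))

  ∈-｛0｝⁻ : ∀ {x} → x ∈ ｛0｝ → x ≈ 0#
  ∈-｛0｝⁻ = index-injective ∘ Sub.x∈⁅y⁆⇒x≡y _

  ∈-ˣ : ∀ {x} {A : Subset n} → x ∈ A → ¬ x ≈ 0# → x ∈ A ˣ
  ∈-ˣ x∈A x≉0 = Sub.x∈p∧x∉q⇒x∈p─q x∈A (x≉0 ∘ ∈-｛0｝⁻)

  list : Subset n → List Carrier
  list A = map element (members A)

  length-list : ∀ A → length (list A) ≡ ∣ A ∣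
  length-list A = ≡.trans (length-map element (members A)) (length-members A)

  unique-list : ∀ A → Unique (list A)
  unique-list A = Unique.map⁺ (≡.setoid _) setoid element-injective (unique-members A)

  ∈-list⁺ : ∀ {x} {A : Subset n} → x ∈ A → x ∈ₗ list A
  ∈-list⁺ {x} {A} x∈A = Membership.∈-resp-≈ setoid (element-index x)
    (Membership.∈-map⁺ (≡.setoid _) setoid (λ { ≡.refl → refl }) (∈-members⁺ x∈A))

  all-list : ∀ A → All (_∈ A) (list A)
  all-list A = All.map⁺ (All.map (λ {i} → ≡.subst (Sub._∈ A) (≡.sym (index-element i))) (all-members A))

  ∈-list⁻ : ∀ {x} {A : Subset n} → x ∈ₗ list A → x ∈ A
  ∈-list⁻ {x} {A} x∈ = All.lookupₛ setoid (λ x≈y → ∈-resp-≈ {A = A} x≈y) (all-list A) x∈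

  -- The common form to which both versions of the clique condition are reduced; the subfield
  -- satisfies it with itself in place of S.
  DifferencesIn : Subset n → Subset n → Set (c ⊔ ℓ₁)
  DifferencesIn S A = ∀ {x y} → x ∈ A → y ∈ A → ¬ x ≈ y → x - y ∈ S

-- The clique A and the set B of inverses

module Clique {c ℓ₁ ℓ₂ n} (F : FiniteField c ℓ₁ ℓ₂ n) (S A : Subset n)
  (0∈A : SubsetsOf._∈_ F (FiniteField.0# F) A) (1∈A : SubsetsOf._∈_ F (FiniteField.1# F) A)
  (differences : SubsetProperties.DifferencesIn F S A) where
  open FiniteFieldProperties F
  open SubsetsOf F
  open CommutativeRing R hiding (zero; 0#; 1#)
  open SubsetProperties F
  open SetoidMembership setoid using () renaming (_∈_ to _∈ₗ_)
  open SetoidUnique setoid using (Unique)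
  open UniqueLists setoid
  open ↭ using (_↭_)
  open SetoidPermutationProperties setoid using (Unique-resp-↭; ∈-resp-↭; xs↭ys⇒|xs|≡|ys|)
  open import Algebra.Properties.Ring ring using ([y-z]x≈yx-zx)
  open import Algebra.Solver.Ring.NaturalCoefficients.Default commutativeSemiring
    using (solve; _:=_; _:+_; _:*_; con)
  open import Relation.Binary.Reasoning.Setoid setoid

  private
    split-0 : ∃ λ xs → 0# ∷ xs ↭ list A
    split-0 = ∈⇒∃↭ (∈-list⁺ {A = A} 0∈A)

  A∖0 : List Carrier
  A∖0 = proj₁ split-0

  0∷A∖0↭A : 0# ∷ A∖0 ↭ list A
  0∷A∖0↭A = proj₂ split-0

  -- Listings of A and B with 0 in front, the shape in which `inner-vanish` takes its hypotheses.
  A₀ B₀ : List Carrier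
  A₀ = 0# ∷ A∖0
  B₀ = 0# ∷ map inv A∖0

  length-A₀ : length A₀ ≡ ∣ A ∣
  length-A₀ = ≡.trans (xs↭ys⇒|xs|≡|ys| 0∷A∖0↭A) (length-list A)

  unique-A₀ : Unique A₀
  unique-A₀ = Unique-resp-↭ (↭.↭-sym 0∷A∖0↭A) (unique-list A)

  ∈-A₀⁻ : ∀ {x} → x ∈ₗ A₀ → x ∈ A
  ∈-A₀⁻ x∈ = ∈-list⁻ {A = A} (∈-resp-↭ 0∷A∖0↭A x∈)

  ∈-A∖0⁺ : ∀ {x} → x ∈ A → ¬ x ≈ 0# → x ∈ₗ A∖0
  ∈-A∖0⁺ x∈A x≉0 = ∈-tail (x≉0 ∘ sym) (∈-resp-↭ (↭.↭-sym 0∷A∖0↭A) (∈-list⁺ {A = A} x∈A))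

  A∖0≉0 : All (λ x → ¬ x ≈ 0#) A∖0
  A∖0≉0 with 0≉ ∷ _ ← unique-A₀ = All.map (_∘ sym) 0≉

  ∈-A∖0⇒≉0 : ∀ {x} → x ∈ₗ A∖0 → ¬ x ≈ 0#
  ∈-A∖0⇒≉0 = All.lookupₛ setoid (λ x≈y x≉0 y≈0 → x≉0 (trans x≈y y≈0)) A∖0≉0

  unique-A∖0 : Unique A∖0
  unique-A∖0 with _ ∷ u ← unique-A₀ = u

  unique-B₀ : Unique B₀
  unique-B₀ = All.map⁺ (All.map (λ x≉0 0≈x⁻¹ → 1≉0 (trans (sym (inverseʳ x≉0)) (trans (*-congˡ (sym 0≈x⁻¹)) (zeroʳ _)))) A∖0≉0)
            ∷ unique-map-on setoid setoid inv-injective A∖0≉0 unique-A∖0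
    where
    inv-injective : ∀ {x y} → ¬ x ≈ 0# → ¬ y ≈ 0# → inv x ≈ inv y → x ≈ y
    inv-injective {x} {y} x≉0 y≉0 eq = begin
      x                  ≈⟨ *-identityʳ x ⟨
      x * 1#             ≈⟨ *-congˡ (inverseʳ y≉0) ⟨
      x * (y * inv y)    ≈⟨ *-congˡ (*-congˡ eq) ⟨
      x * (y * inv x)    ≈⟨ solve 3 (λ x y x′ → x :* (y :* x′) := y :* (x :* x′)) refl x y (inv x) ⟩
      y * (x * inv x)    ≈⟨ *-congˡ (inverseʳ x≉0) ⟩
      y * 1#             ≈⟨ *-identityʳ y ⟩
      y                  ∎

  length-B₀ : length B₀ ≡ ∣ A ∣
  length-B₀ = ≡.trans (≡.cong suc (length-map inv A∖0)) length-A₀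

  ∈-B₀⁻ : ∀ {b} → b ∈ₗ B₀ → b ≈ 0# ⊎ ∃ λ x → x ∈ A × ¬ x ≈ 0# × b * x ≈ 1#
  ∈-B₀⁻ (here b≈0) = inj₁ b≈0
  ∈-B₀⁻ (there b∈) with x , x∈ , b≈x⁻¹ ← Membership.∈-map⁻ setoid setoid b∈ =
    inj₂ (x , ∈-A₀⁻ (there x∈) , ∈-A∖0⇒≉0 x∈ , trans (*-congʳ b≈x⁻¹) (trans (*-comm _ _) (inverseʳ (∈-A∖0⇒≉0 x∈))))

  -- As 0 is in A, x is the difference x - 0.
  nonzero∈S : ∀ {x} → x ∈ A → ¬ x ≈ 0# → x ∈ S
  nonzero∈S x∈A x≉0 = ∈-resp-≈ {A = S} (x-0≈x _) (differences x∈A 0∈A x≉0)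

  1∈S : 1# ∈ S
  1∈S = nonzero∈S 1∈A 1≉0

  -- u lies in S S⁻¹ S⁻¹.
  Quotient : Carrier → Set (c ⊔ ℓ₁)
  Quotient u = ∃ λ s → ∃ λ a → ∃ λ b → s ∈ S × a ∈ S × b ∈ S × u * (a * b) ≈ s

  -- The difference is itself in S, and 1 ∈ S serves as both denominators.
  A-quotient : ∀ {x y} → x ∈ₗ A₀ → y ∈ₗ A₀ → ¬ x ≈ y → Quotient (x - y)
  A-quotient x∈ y∈ x≉y = _ , 1# , 1# , differences (∈-A₀⁻ x∈) (∈-A₀⁻ y∈) x≉y , 1∈S , 1∈S ,
    trans (*-congˡ (*-identityˡ 1#)) (*-identityʳ _)

  -- For b = 1/x and d = 1/y the quotient is (y - x)/(x y), with numerator a difference of elements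
  -- of A. If one of b, d is 0, a denominator 1 fills the gap.
  B-quotient : ∀ {b d} → b ∈ₗ B₀ → d ∈ₗ B₀ → ¬ b ≈ d → Quotient (b - d)
  B-quotient {b} {d} b∈ d∈ b≉d with ∈-B₀⁻ b∈ | ∈-B₀⁻ d∈
  ... | inj₁ b≈0 | inj₁ d≈0 = contradiction (trans b≈0 (sym d≈0)) b≉d
  -- Here -1/y = (0 - 1)/(1 y), whose numerator is a difference of the elements 0 and 1 of A.
  ... | inj₁ b≈0 | inj₂ (y , y∈A , y≉0 , dy≈1) =
    _ , 1# , y , differences 0∈A 1∈A (1≉0 ∘ sym) , 1∈S , nonzero∈S y∈A y≉0 , (begin
      (b - d) * (1# * y)   ≈⟨ *-congˡ (*-identityˡ y) ⟩
      (b - d) * y          ≈⟨ [y-z]x≈yx-zx y b d ⟩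
      b * y - d * y        ≈⟨ +-cong (trans (*-congʳ b≈0) (zeroˡ y)) (-‿cong dy≈1) ⟩
      0# - 1#              ∎)
  ... | inj₂ (x , x∈A , x≉0 , bx≈1) | inj₁ d≈0 =
    _ , x , 1# , 1∈S , nonzero∈S x∈A x≉0 , 1∈S , (begin
      (b - d) * (x * 1#)   ≈⟨ *-congˡ (*-identityʳ x) ⟩
      (b - d) * x          ≈⟨ [y-z]x≈yx-zx x b d ⟩
      b * x - d * x        ≈⟨ +-cong bx≈1 (-‿cong (trans (*-congʳ d≈0) (zeroˡ x))) ⟩
      1# - 0#              ≈⟨ x-0≈x 1# ⟩
      1#                   ∎)
  ... | inj₂ (x , x∈A , x≉0 , bx≈1) | inj₂ (y , y∈A , y≉0 , dy≈1) =
    _ , x , y , differences y∈A x∈A y≉x , nonzero∈S x∈A x≉0 , nonzero∈S y∈A y≉0 , (begin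
      (b - d) * (x * y)              ≈⟨ [y-z]x≈yx-zx (x * y) b d ⟩
      b * (x * y) - d * (x * y)      ≈⟨ +-cong left (-‿cong right) ⟩
      y - x                          ∎)
    where
    left : b * (x * y) ≈ y
    left = trans (sym (*-assoc b x y)) (trans (*-congʳ bx≈1) (*-identityˡ y))
    right : d * (x * y) ≈ x
    right = trans (solve 3 (λ d x y → d :* (x :* y) := (d :* y) :* x) refl d x y) (trans (*-congʳ dy≈1) (*-identityˡ x))
    y≉x : ¬ y ≈ x
    y≉x y≈x = b≉d (*-cancelˡ x≉0 (trans (*-comm x b) (trans bx≈1 (trans (sym dy≈1) (trans (*-congˡ y≈x) (*-comm d x))))))

-- Counting, and rigidity of the clique

open import Data.Nat.Base using (_+_; _*_; _^_; _≤_)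

-- Here n = q², m is the size of the product set, and G that of its complement without 0. Since m <
-- n - m, n + 1 = m + (n - m) + 1 ≤ 2 (n - m) ≤ 2 (G + 1).
2m+1≤n⇒n≤2G+1 : ∀ {m n G} → 2 * m + 1 ≤ n → n ℕ.∸ m ≤ suc G → n ≤ 2 * G + 1
2m+1≤n⇒n≤2G+1 {m} {n} {G} 2m<n n∸m≤1+G = ℕ.+-cancelʳ-≤ 1 n (2 * G + 1) (begin
  n + 1                                ≡⟨ ≡.cong (_+ 1) (≡.sym m+l≡n) ⟩
  m + l + 1                            ≡⟨ solve 2 (λ m l → m :+ l :+ con 1 := l :+ (m :+ con 1)) ≡.refl m l ⟩
  l + (m + 1)                          ≤⟨ ℕ.+-mono-≤ n∸m≤1+G (ℕ.≤-trans m+1≤l n∸m≤1+G) ⟩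
  suc G + suc G                        ≡⟨ solve 1 (λ g → (con 1 :+ g) :+ (con 1 :+ g) := con 2 :* g :+ con 1 :+ con 1) ≡.refl G ⟩
  2 * G + 1 + 1                        ∎)
  where
  open ℕ.≤-Reasoning
  open +-*-Solver
  l = n ℕ.∸ m
  m+l≡n : m + l ≡ n
  m+l≡n = ℕ.m+[n∸m]≡n (ℕ.≤-trans (ℕ.m≤m+n m (m + 0)) (ℕ.≤-trans (ℕ.m≤m+n (2 * m) 1) 2m<n))
  m+1≤l : m + 1 ≤ l
  m+1≤l = ℕ.+-cancelˡ-≤ m (m + 1) l (begin
    m + (m + 1)  ≡⟨ solve 1 (λ m → m :+ (m :+ con 1) := con 2 :* m :+ con 1) ≡.refl m ⟩
    2 * m + 1    ≤⟨ 2m<n ⟩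
    n            ≡⟨ m+l≡n ⟨
    m + l        ∎)

module Rigidity {c ℓ₁ ℓ₂} {p} (p-prime : Prime p) (k : ℕ)
  (F : FiniteField c ℓ₁ ℓ₂ ((p ^ suc k) ^ 2)) (S A : Subset ((p ^ suc k) ^ 2))
  (0∉S : SubsetsOf._∉_ F (FiniteField.0# F) S) (∣A∣≡q : ∣ A ∣ ≡ p ^ suc k)
  (0∈A : SubsetsOf._∈_ F (FiniteField.0# F) A) (1∈A : SubsetsOf._∈_ F (FiniteField.1# F) A)
  (differences : SubsetProperties.DifferencesIn F S A) where
  open FiniteFieldProperties F
  open SubsetsOf F
  open CommutativeRing R hiding (zero; 0#; 1#; _+_) renaming (_*_ to _⋆_)
  open ElementarySymmetric R using (e)
  open import Algebra.Properties.Semiring.Mult semiring using (×-congˡ) renaming (_×_ to _·_)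
  open import Algebra.Properties.Semiring.Exp semiring using () renaming (_^_ to _↑_)
  open import Algebra.Solver.Ring.NaturalCoefficients.Default commutativeSemiring
    using (solve; _:=_; _:*_)
  open import Algebra.Properties.Group +-group
    using () renaming (x∙y⁻¹≈ε⇒x≈y to x-y≈0⇒x≈y; x≈y⇒x∙y⁻¹≈ε to x≈y⇒x-y≈0)
  open import Relation.Binary.Reasoning.Setoid setoid
  open SubsetProperties F
  open Clique F S A 0∈A 1∈A differences
  open SetoidMembership setoid using () renaming (_∈_ to _∈ₗ_)
  open SetoidUnique setoid using (Unique)

  private
    q  = p ^ suc k
    q² = q ^ 2

    q²≡q*q : q ^ 2 ≡ q * q
    q²≡q*q = ≡.cong (q *_) (ℕ.*-identityʳ q)

    1<q : 1 ℕ.< q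
    1<q = ℕ.<-≤-trans (ℕ.nonTrivial⇒n>1 p {{prime⇒nonTrivial p-prime}})
            (ℕ.m≤m*n p (p ^ k) {{ℕ.m^n≢0 p k {{prime⇒nonZero p-prime}}}})

    -- The field has p ^ (2 (k + 1)) elements, so `n·1≈0` kills a power of p.
    p·1≈0 : p · 1# ≈ 0#
    p·1≈0 = p^k·1≈0⇒p·1≈0 p (suc k * 2) (trans (×-congˡ (≡.sym (ℕ.^-*-assoc p (suc k) 2))) n·1≈0)

    1+|A∖0|≡q : suc (length A∖0) ≡ q
    1+|A∖0|≡q = ≡.trans length-A₀ ∣A∣≡q

    0<|A∖0| : 0 ℕ.< length A∖0
    0<|A∖0| = ℕ.s≤s⁻¹ (≡.subst (1 ℕ.<_) (≡.sym 1+|A∖0|≡q) 1<q)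

    ∈S⇒≉0 : ∀ {x} → x ∈ S → ¬ x ≈ 0#
    ∈S⇒≉0 x∈S x≈0 = 0∉S (∈-resp-≈ {A = S} x≈0 x∈S)

    inverse∈ : ∀ {x} → x ∈ S → inv x ∈ S ⁻¹
    inverse∈ x∈S = ∈-⁻¹ {A = S} x∈S (inverseʳ (∈S⇒≉0 x∈S))

    -- Solves s/(a b) = z d for z. The inverse d′ of d stays a parameter because it is factored
    -- differently for B and for the subfield.
    quotient-solve : ∀ {z u s a b d d′} → ¬ a ≈ 0# → ¬ b ≈ 0# → u ⋆ (a ⋆ b) ≈ s → u ≈ z ⋆ d → d ⋆ d′ ≈ 1# →
                     s ⋆ inv a ⋆ inv b ⋆ d′ ≈ z
    quotient-solve {z} {u} {s} {a} {b} {d} {d′} a≉0 b≉0 uab≈s u≈zd dd′≈1 = begin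
      s ⋆ inv a ⋆ inv b ⋆ d′
        ≈⟨ *-congʳ (*-congʳ (*-congʳ (trans (sym uab≈s) (*-congʳ u≈zd)))) ⟩
      z ⋆ d ⋆ (a ⋆ b) ⋆ inv a ⋆ inv b ⋆ d′
        ≈⟨ solve 7 (λ z d a b a′ b′ d′ → z :* d :* (a :* b) :* a′ :* b′ :* d′ := z :* (a :* a′) :* (b :* b′) :* (d :* d′)) refl
             z d a b (inv a) (inv b) d′ ⟩
      z ⋆ (a ⋆ inv a) ⋆ (b ⋆ inv b) ⋆ (d ⋆ d′)
        ≈⟨ *-cong (*-cong (*-congˡ (inverseʳ a≉0)) (inverseʳ b≉0)) dd′≈1 ⟩
      z ⋆ 1# ⋆ 1# ⋆ 1#
        ≈⟨ trans (*-identityʳ _) (trans (*-identityʳ _) (*-identityʳ z)) ⟩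
      z ∎

  -- The set T collects the z to be avoided: for nonzero z outside it, the sums a + z c, with a in
  -- `A₀` or `B₀` and c in `ys`, do not repeat.
  Tiles : Subset q² → List Carrier → Set _
  Tiles T ys = ∀ {z u c c′} → Quotient u → c ∈ₗ ys → c′ ∈ₗ ys → ¬ c ≈ c′ → u ≈ z ⋆ (c - c′) → z ∈ T

  -- The nonzero elements outside T form Z. Applying `e-copies` to `A₀` and to `B₀`, with the same
  -- `ys`, yields the two ranges that `inner-vanish` joins.
  inner-vanishing : ∀ T ys → Unique ys → length ys ≡ q → 2 * ∣ T ∣ + 1 ≤ q² → Tiles T ys →
                    ∀ j → 0 ℕ.< j → j ℕ.< length A∖0 → e A∖0 j ≈ 0#
  inner-vanishing T ys ys! |ys|≡q small tiles
    with zs , zs! , zs-good , |∁T|≤1+|zs| ← remove-0 (unique-list (∁ T)) =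
    inner-vanish {G = length zs} A∖0≉0 large
      (low A₀ unique-A₀ (≡.trans length-A₀ ∣A∣≡q) A-quotient)
      (low B₀ unique-B₀ (≡.trans length-B₀ ∣A∣≡q) B-quotient)
    where
    large : suc (length A∖0) * suc (length A∖0) ≤ 2 * length zs + 1
    large = ≡.subst (_≤ 2 * length zs + 1) (≡.trans q²≡q*q (≡.cong (λ m → m * m) (≡.sym 1+|A∖0|≡q)))
      (2m+1≤n⇒n≤2G+1 {m = ∣ T ∣} small
        (≡.subst (_≤ suc (length zs)) (≡.trans (length-list (∁ T)) (Sub.∣∁p∣≡n∸∣p∣ T)) |∁T|≤1+|zs|))
    low : ∀ xs → Unique xs → length xs ≡ q → (∀ {x y} → x ∈ₗ xs → y ∈ₗ xs → ¬ x ≈ y → Quotient (x - y)) →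
          ∀ i → 0 ℕ.< i → i * suc (length A∖0) ℕ.< length zs → e xs i ≈ 0#
    low xs xs! |xs|≡q quotient i 0<i iq<G = e-of-copies≈0 p-prime p·1≈0 (suc k) xs i
      (≡.subst₂ (λ m r → e (concatMap (replicate m) xs) (i * r) ≈ 0#) |ys|≡q 1+|A∖0|≡q
        (e-copies xs! ys! (≡.trans (≡.cong₂ _*_ |xs|≡q |ys|≡q) (≡.sym q²≡q*q)) zs! (All.map proj₁ zs-good)
          (All.map separated zs-good) (ℕ.*-mono-≤ 0<i (ℕ.s≤s ℕ.z≤n)) iq<G))
      where
      separated : ∀ {z} → ¬ z ≈ 0# × z ∈ₗ list (∁ T) → ∀ {a a′ c c′} → a ∈ₗ xs → a′ ∈ₗ xs → c ∈ₗ ys → c′ ∈ₗ ys →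
                  ¬ c ≈ c′ → ¬ a - a′ ≈ z ⋆ (c - c′)
      separated {z} (z≉0 , z∈∁T) {a} {a′} a∈ a′∈ c∈ c′∈ c≉c′ eq =
        Sub.x∈∁p⇒x∉p (∈-list⁻ {A = ∁ T} z∈∁T) (tiles (quotient a∈ a′∈ a≉a′) c∈ c′∈ c≉c′ eq)
        where
        -- Otherwise z (c - c′) = 0 with z nonzero, against c ≠ c′.
        a≉a′ : ¬ a ≈ a′
        a≉a′ a≈a′ = c≉c′ (x-y≈0⇒x≈y _ _ (*-cancel-0 z _ z≉0 (trans (sym eq) (x≈y⇒x-y≈0 a≈a′))))

  -- A difference in B is t/(x y), so dividing s/(a b) by it gives s x y/(a b t), with three factors
  -- from S above and three below.
  tiles-B₀ : Tiles (S ⊛ S ⊛ S ⊛ S ⁻¹ ⊛ S ⁻¹ ⊛ S ⁻¹) B₀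
  tiles-B₀ {z} {u} {c} {c′} (s , a , b , s∈S , a∈S , b∈S , uab≈s) c∈ c′∈ c≉c′ u≈zd
    with t , x , y , t∈S , x∈S , y∈S , dxy≈t ← B-quotient c∈ c′∈ c≉c′ =
    ∈-resp-≈ {A = S ⊛ S ⊛ S ⊛ S ⁻¹ ⊛ S ⁻¹ ⊛ S ⁻¹} (begin
      s ⋆ x ⋆ y ⋆ inv a ⋆ inv b ⋆ inv t
        ≈⟨ solve 6 (λ s x y a b t → s :* x :* y :* a :* b :* t := s :* a :* b :* (x :* y :* t)) refl
             s x y (inv a) (inv b) (inv t) ⟩
      s ⋆ inv a ⋆ inv b ⋆ (x ⋆ y ⋆ inv t)
        ≈⟨ quotient-solve (∈S⇒≉0 a∈S) (∈S⇒≉0 b∈S) uab≈s u≈zd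
             (trans (sym (*-assoc _ _ _)) (trans (*-congʳ dxy≈t) (inverseʳ (∈S⇒≉0 t∈S)))) ⟩
      z ∎)
      (∈-⊛ {A = S ⊛ S ⊛ S ⊛ S ⁻¹ ⊛ S ⁻¹} {B = S ⁻¹}
        (∈-⊛ {A = S ⊛ S ⊛ S ⊛ S ⁻¹} {B = S ⁻¹}
          (∈-⊛ {A = S ⊛ S ⊛ S} {B = S ⁻¹} (∈-⊛ {A = S ⊛ S} {B = S} (∈-⊛ {A = S} {B = S} s∈S x∈S) y∈S) (inverse∈ a∈S))
          (inverse∈ b∈S))
        (inverse∈ t∈S))

  module _ {Fq : Subset q²} (subfield : IsSubfield Fq) where
    open IsSubfield subfield

    -- Differences of subfield elements stay in the subfield, so dividing by a nonzero one
    -- multiplies by an element of `Fq ˣ`.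
    tiles-subfield : Tiles (S ⊛ S ⁻¹ ⊛ S ⁻¹ ⊛ Fq ˣ) (list Fq)
    tiles-subfield {z} {u} {c} {c′} (s , a , b , s∈S , a∈S , b∈S , uab≈s) c∈ c′∈ c≉c′ u≈zd =
      ∈-resp-≈ {A = S ⊛ S ⁻¹ ⊛ S ⁻¹ ⊛ Fq ˣ} (quotient-solve (∈S⇒≉0 a∈S) (∈S⇒≉0 b∈S) uab≈s u≈zd dd′≈1)
        (∈-⊛ {A = S ⊛ S ⁻¹ ⊛ S ⁻¹} {B = Fq ˣ}
          (∈-⊛ {A = S ⊛ S ⁻¹} {B = S ⁻¹} (∈-⊛ {A = S} {B = S ⁻¹} s∈S (inverse∈ a∈S)) (inverse∈ b∈S))
          (∈-ˣ {A = Fq} (inv-closed d (inv d) d∈Fq dd′≈1) λ d′≈0 → 1≉0 (trans (sym dd′≈1) (trans (*-congˡ d′≈0) (zeroʳ d)))))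
      where
      d = c - c′
      d∈Fq : d ∈ Fq
      d∈Fq = +-closed c (- c′) (∈-list⁻ {A = Fq} c∈) (neg-closed c′ (∈-list⁻ {A = Fq} c′∈))
      d≉0 : ¬ d ≈ 0#
      d≉0 = c≉c′ ∘ x-y≈0⇒x≈y _ _
      dd′≈1 : d ⋆ inv d ≈ 1#
      dd′≈1 = inverseʳ d≉0

    -- By `fermat` the nonzero elements of the subfield are roots of X ^ (q - 1) - 1, hence lie in
    -- A; equal cardinalities turn the inclusion into equality.
    subfield-≡ : ∣ Fq ∣ ≡ q → (∀ j → 0 ℕ.< j → j ℕ.< length A∖0 → e A∖0 j ≈ 0#) → A ≡ Fq
    subfield-≡ ∣Fq∣≡q inner = ≡.sym (⊆∧∣∣≡⇒≡ Fq⊆A (≡.trans ∣Fq∣≡q (≡.sym ∣A∣≡q)))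
      where
      Fq-differences : DifferencesIn Fq Fq
      Fq-differences {x} {y} x∈ y∈ _ = +-closed x (- y) x∈ (neg-closed y y∈)
      -- The subfield is a clique for itself, which supplies the listing of its nonzero elements.
      module K = Clique F Fq Fq 0∈ 1∈ Fq-differences
      |K∖0|≡|A∖0| : length K.A∖0 ≡ length A∖0
      |K∖0|≡|A∖0| = ℕ.suc-injective (≡.trans K.length-A₀ (≡.trans ∣Fq∣≡q (≡.sym 1+|A∖0|≡q)))
      power : ∀ {x} → x ∈ Fq → ¬ x ≈ 0# → x ↑ length A∖0 ≈ 1#
      power {x} x∈Fq x≉0 = ≡.subst (λ m → x ↑ m ≈ 1#) |K∖0|≡|A∖0|
        (fermat K.unique-A∖0 K.A∖0≉0 x≉0 (All.tabulateₛ setoid λ {y} y∈ →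
          K.∈-A∖0⁺ (*-closed x y x∈Fq (K.∈-A₀⁻ (there y∈))) (*-≉0 x≉0 (K.∈-A∖0⇒≉0 y∈))))
      member : ∀ x → x ∈ Fq → x ∈ A
      member x x∈Fq with x ≟ 0# | any? (x ≟_) A∖0
      ... | yes x≈0 | _         = ∈-resp-≈ {A = A} (sym x≈0) 0∈A
      ... | no _    | yes x∈A∖0 = ∈-A₀⁻ (there x∈A∖0)
      -- Membership is decidable, so refuting non-membership suffices.
      ... | no x≉0  | no x∉A∖0  = contradiction
        (λ {y} y∈ x≈y → x∉A∖0 (Membership.∈-resp-≈ setoid (sym x≈y) y∈))
        (contains-roots-of-unity unique-A∖0 A∖0≉0 (∈-A∖0⁺ 1∈A 1≉0) inner 0<|A∖0| (power x∈Fq x≉0))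
      Fq⊆A : Fq ⊆ A
      Fq⊆A {i} i∈Fq = ≡.subst (Sub._∈ A) (index-element i)
        (member (FiniteField.element F i) (≡.subst (Sub._∈ Fq) (≡.sym (index-element i)) i∈Fq))

theorem1p1 : ∀ {c ℓ₁ ℓ₂} (q : ℕ) → IsPrimePower q →
    (F : FiniteField c ℓ₁ ℓ₂ (q ^ 2)) →
    let open SubsetsOf F in
    (Fq : Subset (q ^ 2)) → IsSubfield Fq → ∣ Fq ∣ ≡ q →
    (S : Subset (q ^ 2)) → 0# ∉ S → S ≡ ⊝ S →
    (2 * ∣ S ⊛ S ⊛ S ⊛ S ⁻¹ ⊛ S ⁻¹ ⊛ S ⁻¹ ∣ + 3 ≤ q ^ 2)
    ⊎ (2 * ∣ S ⊛ S ⁻¹ ⊛ S ⁻¹ ⊛ Fq ˣ ∣ + 1 ≤ q ^ 2) →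
    (∀ (A : Subset (q ^ 2)) → ∣ A ∣ ≡ q → 0# ∈ A → 1# ∈ A →
    A ⊖ A ⊆ S ∪ ｛0｝ → A ≡ Fq)
    × (∀ (A : Subset (q ^ 2)) → ∣ A ∣ ≡ q → 0# ∈ A → 1# ∈ A →
    IsClique (Cay S) A → A ≡ Fq)
theorem1p1 _ (p , k , p-prime , ≡.refl) F Fq subfield ∣Fq∣≡q S 0∉S _ small =
  (λ A ∣A∣≡q 0∈A 1∈A A⊖A⊆S∪0 → rigid A ∣A∣≡q 0∈A 1∈A λ {x} {y} x∈A y∈A x≉y →
    -- A difference of distinct elements cannot fall into {0}.
    [ (λ x-y∈S → x-y∈S) , (λ x-y∈0 → contradiction (x∙y⁻¹≈ε⇒x≈y x y (∈-｛0｝⁻ x-y∈0)) x≉y) ]′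
      (Sub.x∈p∪q⁻ S ｛0｝ (A⊖A⊆S∪0 (∈-⊖ {A = A} {B = A} x∈A y∈A)))) ,
  λ A ∣A∣≡q 0∈A 1∈A clique → rigid A ∣A∣≡q 0∈A 1∈A (clique _ _)
  where
  open SubsetsOf F
  open SubsetProperties F
  open import Algebra.Properties.Group (CommutativeRing.+-group (FiniteFieldProperties.R F)) using (x∙y⁻¹≈ε⇒x≈y)
  rigid : ∀ A → ∣ A ∣ ≡ p ^ suc k → 0# ∈ A → 1# ∈ A → DifferencesIn S A → A ≡ Fq
  rigid A ∣A∣≡q 0∈A 1∈A differences = subfield-≡ subfield ∣Fq∣≡q
    -- The first hypothesis takes C = B, its bound being relaxed to the form shared by both cases.
    ([ (λ small → inner-vanishing (S ⊛ S ⊛ S ⊛ S ⁻¹ ⊛ S ⁻¹ ⊛ S ⁻¹) B₀ unique-B₀ (≡.trans length-B₀ ∣A∣≡q)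
                    (ℕ.≤-trans (ℕ.+-monoʳ-≤ (2 * ∣ S ⊛ S ⊛ S ⊛ S ⁻¹ ⊛ S ⁻¹ ⊛ S ⁻¹ ∣) (ℕ.s≤s ℕ.z≤n)) small) tiles-B₀)
     -- The second hypothesis takes the subfield as C.
     , (λ small → inner-vanishing (S ⊛ S ⁻¹ ⊛ S ⁻¹ ⊛ Fq ˣ) (list Fq) (unique-list Fq) (≡.trans (length-list Fq) ∣Fq∣≡q)
                    small (tiles-subfield subfield))
     ]′ small)
    where
    open Rigidity p-prime k F S A 0∉S ∣A∣≡q 0∈A 1∈A differences
    open Clique F S A 0∈A 1∈A differences
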